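{- Let $w$ be an infinite word over an alphabet $\Sigma$ with $|\Sigma|\ge2$ generated by a morphism $\phi$ with $\det A_\phi\ne\pm1$. Then $w$ does not satisfy the WELLDOC property.
   Context: $\Sigma=\{0,\dots,\sigma-1\}$. A morphism is nonerasing; $w$ is generated by $\phi$ if $\phi(a)=as$ with $s$ nonempty and $w=\lim_n\phi^n(a)$. $A_\phi$ is the $\sigma\times\sigma$ matrix with entry $|\phi(i)|_j$ in row $j$, column $i$. Parikh vector $V_u=(|u|_0,\dots,|u|_{\sigma-1})$; for a factor $u$ occurring at positions $a_0<a_1<\dots$, $X_u=\{V_{w[0,a_i)}\}$, $X_{u,m}$ its reduction mod $m$; WELLDOC means $X_{u,m}=(\mathbb{Z}/m\mathbb{Z})^\sigma$ for all $m\ge1$ and all factors $u$ of $w$. -}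

module Defs where

open import Data.Nat as ℕ using (ℕ; zero; suc; _+_; _%_; NonZero)
open import Data.Integer as ℤ using (ℤ; +_; -[1+_])
open import Data.Fin using (Fin; zero; suc; punchIn; _≟_)
open import Data.List using (List; []; _∷_; concatMap)
open import Data.Product using (Σ; ∃; ∃-syntax; _×_; _,_)
open import Data.Unit using (⊤)
open import Relation.Nullary using (¬_; yes; no)
open import Relation.Binary.PropositionalEquality using (_≡_)

Word : ℕ → Set
Word σ = ℕ → Fin σ

Morphism : ℕ → Set
Morphism σ = Fin σ → List (Fin σ)

Nonerasing : ∀ {σ} → Morphism σ → Set
Nonerasing {σ} φ = (i : Fin σ) → ¬ (φ i ≡ [])

φ* : ∀ {σ} → Morphism σ → List (Fin σ) → List (Fin σ)
φ* φ = concatMap φ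

iter : ∀ {σ} → Morphism σ → ℕ → List (Fin σ) → List (Fin σ)
iter φ zero    u = u
iter φ (suc n) u = φ* φ (iter φ n u)

StartsWith : ∀ {σ} → Word σ → List (Fin σ) → Set
StartsWith w []      = ⊤
StartsWith w (x ∷ u) = (w 0 ≡ x) × StartsWith (λ k → w (suc k)) u

-- w is generated by φ: φ(a) = a s with s nonempty and w = lim φⁿ(a),
-- i.e. every φⁿ(a) is a prefix of w (the lengths tend to infinity).
GeneratedBy : ∀ {σ} → Word σ → Morphism σ → Set
GeneratedBy {σ} w φ =
  Nonerasing φ ×
  (Σ (Fin σ) λ a → Σ (List (Fin σ)) λ s →
     (φ a ≡ a ∷ s) × ¬ (s ≡ []) × ((n : ℕ) → StartsWith w (iter φ n (a ∷ []))))

countL : ∀ {σ} → Fin σ → List (Fin σ) → ℕ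
countL j []      = 0
countL j (x ∷ u) with x ≟ j
... | yes _ = suc (countL j u)
... | no  _ = countL j u

Aφ : ∀ {σ} → Morphism σ → Fin σ → Fin σ → ℤ
Aφ φ j i = + countL j (φ i)

sumFin : ∀ {n} → (Fin n → ℤ) → ℤ
sumFin {zero}  f = + 0
sumFin {suc n} f = f zero ℤ.+ sumFin (λ k → f (suc k))

sign : ∀ {n} → Fin n → ℤ
sign zero    = + 1
sign (suc k) = ℤ.- sign k

det : ∀ {n} → (Fin n → Fin n → ℤ) → ℤ
det {zero}  M = + 1
det {suc n} M =
  sumFin (λ k → sign k ℤ.* (M zero k ℤ.* det (λ i j → M (suc i) (punchIn k j))))

OccursAt : ∀ {σ} → Word σ → List (Fin σ) → ℕ → Set
OccursAt w u i = StartsWith (λ k → w (i + k)) u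

IsFactor : ∀ {σ} → Word σ → List (Fin σ) → Set
IsFactor w u = ∃[ i ] OccursAt w u i

prefCount : ∀ {σ} → Word σ → Fin σ → ℕ → ℕ
prefCount w j zero    = 0
prefCount w j (suc i) with w i ≟ j
... | yes _ = suc (prefCount w j i)
... | no  _ = prefCount w j i

-- WELLDOC: for all m ≥ 1 and all factors u, X_{u,m} = (ℤ/mℤ)^σ, i.e. every
-- residue vector (represented by v : Fin σ → ℕ) is hit by some occurrence.
WELLDOC : ∀ {σ} → Word σ → Set
WELLDOC {σ} w =
  (m : ℕ) .{{_ : NonZero m}} (u : List (Fin σ)) → IsFactor w u →
  (v : Fin σ → ℕ) →
  ∃[ i ] (OccursAt w u i × ((j : Fin σ) → prefCount w j i % m ≡ v j % m))

{-# OPTIONS --safe #-}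

-- Let M = A_φ and let a be the letter generating w. Since w = φᴺ(w), the prefix vector at a position of w is
-- congruent modulo Mᴺ ℤ^σ to the Parikh vector of a prefix of some block φᴺ(e). If, for some K independent of N, there
-- is for each N a factor whose occurrences meet at most K cosets of Mᴺ ℤ^σ, then WELLDOC and the pigeonhole principle
-- give K! ℤ^σ ⊆ Mᴺ ℤ^σ modulo every m; taking determinants, det Mᴺ is nonzero and at most (K!)^σ in absolute value,
-- which forces det M = ±1.
-- Such factors exist. If a can be followed by arbitrarily long words without a, take a followed by such a word: its
-- initial a is the last a of its block, so K = σ works. Otherwise a has bounded gaps, so the lengths |φᴺ(e)| are at most
-- some H = c |φᴺ(a)| with c independent of N, and a window of length H is determined by a bounded number R of
-- consecutive letters of w together with an offset below H. As w is not periodic, Morse–Hedlund gives more than H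
-- windows of length H, so one of them comes from at most σᴿ of the σᴿ H choices.
module Submission where

open import Defs
open import Data.Nat using (ℕ; zero; suc; _+_; _*_; _^_; _!; _∸_; _≤_; _<_; _≥_; _%_; _/_; NonZero; z≤n; s≤s; _<?_; _≤?_)
import Data.Nat.Properties as ℕ
import Data.Nat.Divisibility as ℕ∣
open import Data.Nat.DivMod using (m≡m%n+[m/n]*n; m%n<n)
open import Data.Nat.Induction using (<-rec)
open import Data.Integer as ℤ using (ℤ; +_; -[1+_]; 0ℤ; 1ℤ; ∣_∣)
import Data.Integer.Properties as ℤ
open import Data.Integer.Divisibility.Signed as ℤ∣ using (∣m∣n⇒∣m+n; ∣m∣n⇒∣m-n; ∣n⇒∣m*n; ∣m⇒∣m*n)
open import Data.Integer.Tactic.RingSolver using (solve-∀)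
open import Data.Fin as Fin using (Fin; zero; suc; punchIn; punchOut; toℕ; fromℕ<; inject≤; _≟_)
open import Data.Fin.Properties
  using (punchInᵢ≢i; punchIn-punchOut; punchIn-injective; pigeonhole; toℕ<n; fromℕ<-injective; inject≤-injective)
open import Data.List as List
  using (List; []; _∷_; [_]; _++_; length; concatMap; take; drop; filter; map; applyUpTo; upTo; allFin;
         cartesianProduct; cartesianProductWith)
import Data.List.Properties as List
open import Data.List.Membership.Propositional using (_∈_)
open import Data.List.Membership.Propositional.Properties
  using (∈-filter⁺; ∈-allFin; ∈-upTo⁺; ∈-cartesianProduct⁺; ∈-cartesianProductWith⁺)
open import Data.List.Relation.Unary.All as All using (All; []; _∷_)
open import Data.List.Relation.Unary.All.Properties using (all-filter)
open import Data.List.Relation.Unary.AllPairs as AllPairs using (AllPairs; []; _∷_)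
import Data.List.Relation.Unary.AllPairs.Properties as AllPairs
open import Data.List.Relation.Unary.Any as Any using (here; there)
open import Data.List.Relation.Unary.Any.Properties using (lookup-index)
open import Data.Vec.Functional using (tail; insertAt) renaming (_∷_ to infixr 5 _◂_)
open import Data.Vec.Functional.Properties using (insertAt-lookup; insertAt-punchIn)
open import Data.Product using (∃; ∃₂; ∃-syntax; _×_; _,_; proj₁; proj₂)
open import Data.Empty using (⊥; ⊥-elim)
open import Data.Unit using (tt)
open import Function using (_∘_)
open import Relation.Nullary using (¬_; yes; no; ¬?; decidable-stable; contradiction)
open import Relation.Unary using (Decidable)
open import Relation.Binary using (DecidableEquality; tri<; tri≈; tri>)
open import Relation.Binary.PropositionalEquality
  using (_≡_; _≢_; refl; sym; trans; cong; cong₂; subst; module ≡-Reasoning)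

-- Finite integer sums and the identity matrix.

sum-cong : ∀ {n} {f g : Fin n → ℤ} → (∀ k → f k ≡ g k) → sumFin f ≡ sumFin g
sum-cong {zero}  f≗g = refl
sum-cong {suc n} f≗g = cong₂ ℤ._+_ (f≗g zero) (sum-cong (f≗g ∘ suc))

sum-linear : ∀ {n} (s t : ℤ) {f g h : Fin n → ℤ} →
  (∀ k → f k ≡ s ℤ.* g k ℤ.+ t ℤ.* h k) →
  sumFin f ≡ s ℤ.* sumFin g ℤ.+ t ℤ.* sumFin h
sum-linear {zero}  s t eq = lemma s t
  where
  lemma : ∀ s t → 0ℤ ≡ s ℤ.* 0ℤ ℤ.+ t ℤ.* 0ℤ
  lemma = solve-∀
sum-linear {suc n} s t {f} {g} {h} eq =
  trans (cong₂ ℤ._+_ (eq zero) (sum-linear s t (eq ∘ suc)))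
        (lemma s t (g zero) (h zero) (sumFin (g ∘ suc)) (sumFin (h ∘ suc)))
  where
  lemma : ∀ s t a b x y →
    s ℤ.* a ℤ.+ t ℤ.* b ℤ.+ (s ℤ.* x ℤ.+ t ℤ.* y) ≡ s ℤ.* (a ℤ.+ x) ℤ.+ t ℤ.* (b ℤ.+ y)
  lemma = solve-∀

sum-zero : ∀ {n} {f : Fin n → ℤ} → (∀ k → f k ≡ 0ℤ) → sumFin f ≡ 0ℤ
sum-zero {zero}  f≡0 = refl
sum-zero {suc n} f≡0 = cong₂ ℤ._+_ (f≡0 zero) (sum-zero (f≡0 ∘ suc))

Id : ∀ {n} → Fin n → Fin n → ℤ
Id zero    zero    = 1ℤ
Id zero    (suc j) = 0ℤ
Id (suc i) zero    = 0ℤ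
Id (suc i) (suc j) = Id i j

Id-diag : ∀ {n} (i : Fin n) → Id i i ≡ 1ℤ
Id-diag zero    = refl
Id-diag (suc i) = Id-diag i

Id-off : ∀ {n} {i j : Fin n} → i ≢ j → Id i j ≡ 0ℤ
Id-off {i = zero}  {zero}  i≢j = ⊥-elim (i≢j refl)
Id-off {i = zero}  {suc j} i≢j = refl
Id-off {i = suc i} {zero}  i≢j = refl
Id-off {i = suc i} {suc j} i≢j = Id-off (i≢j ∘ cong suc)

Id-punchIn : ∀ {n} (k : Fin (suc n)) (i j : Fin n) → Id (punchIn k i) (punchIn k j) ≡ Id i j
Id-punchIn k i j with i ≟ j
... | yes refl = trans (Id-diag (punchIn k i)) (sym (Id-diag i))
... | no  i≢j  = trans (Id-off (i≢j ∘ punchIn-injective k i j)) (sym (Id-off i≢j))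

sum-Idʳ : ∀ {n} (f : Fin n → ℤ) i → sumFin (λ k → f k ℤ.* Id k i) ≡ f i
sum-Idʳ {suc n} f zero    = trans
  (cong₂ ℤ._+_ (ℤ.*-identityʳ (f zero)) (sum-zero (λ k → ℤ.*-zeroʳ (f (suc k)))))
  (ℤ.+-identityʳ (f zero))
sum-Idʳ {suc n} f (suc i) = trans
  (cong₂ ℤ._+_ (ℤ.*-zeroʳ (f zero)) (sum-Idʳ (f ∘ suc) i))
  (ℤ.+-identityˡ (f (suc i)))

-- Alternating multilinear forms

-- A matrix is passed to a form as the family of its columns.
Cols : ℕ → ℕ → Set
Cols n r = Fin n → Fin r → ℤ

-- Repetition is demanded only of neighbouring columns, which is what row expansion yields directly;
-- other repetitions follow by swaps.
data Adjacent : ∀ {n} → Fin n → Fin n → Set where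
  first : ∀ {n} → Adjacent {suc (suc n)} zero (suc zero)
  later : ∀ {n} {c d : Fin n} → Adjacent c d → Adjacent (suc c) (suc d)

-- Matrices are functions compared pointwise, so `cong-≗` stands in for extensionality, and `linear`
-- relates three matrices agreeing off column `c` instead of naming an updated matrix.
record Alternating {n r : ℕ} (F : Cols n r → ℤ) : Set where
  field
    cong-≗ : ∀ {A B} → (∀ j i → A j i ≡ B j i) → F A ≡ F B
    linear : ∀ c s t {A B C} →
      (∀ i → A c i ≡ s ℤ.* B c i ℤ.+ t ℤ.* C c i) →
      (∀ j → j ≢ c → ∀ i → A j i ≡ B j i) →
      (∀ j → j ≢ c → ∀ i → A j i ≡ C j i) →
      F A ≡ s ℤ.* F B ℤ.+ t ℤ.* F C
    vanish : ∀ {c d} → Adjacent c d → ∀ {A} → (∀ i → A c i ≡ A d i) → F A ≡ 0ℤ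

open Alternating

fix-first : ∀ {n r} {F : Cols (suc n) r → ℤ} → Alternating F →
  ∀ x → Alternating (λ vs → F (x ◂ vs))
fix-first alt x .cong-≗ eq = cong-≗ alt λ { zero i → refl ; (suc j) i → eq j i }
fix-first alt x .linear c s t eq eqB eqC = linear alt (suc c) s t eq
  (λ { zero _ i → refl ; (suc j) j≢c i → eqB j (j≢c ∘ cong suc) i })
  (λ { zero _ i → refl ; (suc j) j≢c i → eqC j (j≢c ∘ cong suc) i })
fix-first alt x .vanish adj eq = vanish alt (later adj) eq

module _ {n r} {F : Cols (suc n) r → ℤ} (alt : Alternating F) where

  linear-first : ∀ s t x y {z} vs → (∀ i → z i ≡ s ℤ.* x i ℤ.+ t ℤ.* y i) →
    F (z ◂ vs) ≡ s ℤ.* F (x ◂ vs) ℤ.+ t ℤ.* F (y ◂ vs)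
  linear-first s t x y vs eq = linear alt zero s t eq
    (λ { zero 0≢0 → ⊥-elim (0≢0 refl) ; (suc j) _ i → refl })
    (λ { zero 0≢0 → ⊥-elim (0≢0 refl) ; (suc j) _ i → refl })

  linear-sum : ∀ {p} (s : Fin p → ℤ) (x : Fin p → Fin r → ℤ) {v} vs →
    (∀ i → v i ≡ sumFin (λ k → s k ℤ.* x k i)) →
    F (v ◂ vs) ≡ sumFin (λ k → s k ℤ.* F (x k ◂ vs))
  linear-sum {zero}  s x {v} vs eq =
    -- The empty sum makes `v` zero, hence a combination of itself with coefficients 0, and products
    -- of `0ℤ` with anything compute to `0ℤ`.
    linear-first 0ℤ 0ℤ v v vs eq
  linear-sum {suc p} s x {v} vs eq = begin
    F (v ◂ vs)
      ≡⟨ linear-first (s zero) 1ℤ (x zero) rest vs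
           (λ i → trans (eq i) (cong (λ a → s zero ℤ.* x zero i ℤ.+ a) (sym (ℤ.*-identityˡ (rest i))))) ⟩
    s zero ℤ.* F (x zero ◂ vs) ℤ.+ 1ℤ ℤ.* F (rest ◂ vs)
      ≡⟨ cong (λ a → s zero ℤ.* F (x zero ◂ vs) ℤ.+ a) (trans (ℤ.*-identityˡ (F (rest ◂ vs))) (linear-sum (s ∘ suc) (x ∘ suc) vs (λ i → refl))) ⟩
    sumFin (λ k → s k ℤ.* F (x k ◂ vs)) ∎
    where
    open ≡-Reasoning
    rest : Fin r → ℤ
    rest i = sumFin (λ k → s (suc k) ℤ.* x (suc k) i)

-- Polarisation: with `x+y` in both places the form is 0, and expanding leaves only the two mixed
-- terms.
swap-first : ∀ {n r} {F : Cols (suc (suc n)) r → ℤ} → Alternating F →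
  ∀ x y vs → F (x ◂ y ◂ vs) ≡ ℤ.- F (y ◂ x ◂ vs)
swap-first {F = F} alt x y vs = lemma _ _ (begin
  0ℤ
    ≡⟨ vanish alt first (λ i → refl) ⟨
  F (x+y ◂ x+y ◂ vs)
    ≡⟨ linear-first alt 1ℤ 1ℤ x y (x+y ◂ vs) (λ i → one (x i) (y i)) ⟩
  1ℤ ℤ.* F (x ◂ x+y ◂ vs) ℤ.+ 1ℤ ℤ.* F (y ◂ x+y ◂ vs)
    ≡⟨ cong₂ (λ a b → 1ℤ ℤ.* a ℤ.+ 1ℤ ℤ.* b) (split x) (split y) ⟩
  1ℤ ℤ.* (1ℤ ℤ.* F (x ◂ x ◂ vs) ℤ.+ 1ℤ ℤ.* F (x ◂ y ◂ vs)) ℤ.+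
  1ℤ ℤ.* (1ℤ ℤ.* F (y ◂ x ◂ vs) ℤ.+ 1ℤ ℤ.* F (y ◂ y ◂ vs))
    ≡⟨ cong₂ (λ a b → 1ℤ ℤ.* (1ℤ ℤ.* a ℤ.+ 1ℤ ℤ.* F (x ◂ y ◂ vs)) ℤ.+
                      1ℤ ℤ.* (1ℤ ℤ.* F (y ◂ x ◂ vs) ℤ.+ 1ℤ ℤ.* b))
         (vanish alt first (λ i → refl)) (vanish alt first (λ i → refl)) ⟩
  1ℤ ℤ.* (1ℤ ℤ.* 0ℤ ℤ.+ 1ℤ ℤ.* F (x ◂ y ◂ vs)) ℤ.+
  1ℤ ℤ.* (1ℤ ℤ.* F (y ◂ x ◂ vs) ℤ.+ 1ℤ ℤ.* 0ℤ) ∎)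
  where
  open ≡-Reasoning
  x+y = λ i → x i ℤ.+ y i
  one : ∀ a b → a ℤ.+ b ≡ 1ℤ ℤ.* a ℤ.+ 1ℤ ℤ.* b
  one = solve-∀
  split : ∀ z → F (z ◂ x+y ◂ vs) ≡ 1ℤ ℤ.* F (z ◂ x ◂ vs) ℤ.+ 1ℤ ℤ.* F (z ◂ y ◂ vs)
  split z = linear-first (fix-first alt z) 1ℤ 1ℤ x y vs (λ i → one (x i) (y i))
  lemma : ∀ a b →
    0ℤ ≡ 1ℤ ℤ.* (1ℤ ℤ.* 0ℤ ℤ.+ 1ℤ ℤ.* a) ℤ.+ 1ℤ ℤ.* (1ℤ ℤ.* b ℤ.+ 1ℤ ℤ.* 0ℤ) → a ≡ ℤ.- b
  lemma a b eq = trans (trans (expand a b) (cong (ℤ._+ ℤ.- b) (sym eq))) (ℤ.+-identityˡ (ℤ.- b))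
    where
    expand : ∀ a b → a ≡
      1ℤ ℤ.* (1ℤ ℤ.* 0ℤ ℤ.+ 1ℤ ℤ.* a) ℤ.+ 1ℤ ℤ.* (1ℤ ℤ.* b ℤ.+ 1ℤ ℤ.* 0ℤ) ℤ.+ ℤ.- b
    expand = solve-∀

cons-η : ∀ {n} {X : Set} (A : Fin (suc n) → X) → ∀ j → A j ≡ (A zero ◂ tail A) j
cons-η A zero    = refl
cons-η A (suc j) = refl

-- Swaps carry `x` to the right until it stands next to its copy; a change of sign does not affect
-- vanishing.
vanish-repeat : ∀ {n r} {F : Cols (suc n) r → ℤ} → Alternating F →
  ∀ x vs j → (∀ i → vs j i ≡ x i) → F (x ◂ vs) ≡ 0ℤ
vanish-repeat alt x vs zero    eq = vanish alt first (sym ∘ eq)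
vanish-repeat {F = F} alt x vs (suc j) eq = begin
  F (x ◂ vs)
    ≡⟨ cong-≗ (fix-first alt x) (λ j i → cong (λ v → v i) (cons-η vs j)) ⟩
  F (x ◂ vs zero ◂ tail vs)
    ≡⟨ swap-first alt x (vs zero) (tail vs) ⟩
  ℤ.- F (vs zero ◂ x ◂ tail vs)
    ≡⟨ cong ℤ.-_ (vanish-repeat (fix-first alt (vs zero)) x (tail vs) j eq) ⟩
  0ℤ ∎
  where open ≡-Reasoning

-- Multiples of `x` are removed column by column; each correction term has `x` as a column and is 0.
-- In the application `x` is a column fixed beforehand.
shear : ∀ {n r} {F : Cols n r → ℤ} → Alternating F → ∀ (x : Fin r → ℤ) →
  (∀ (A : Cols n r) j → (∀ i → A j i ≡ x i) → F A ≡ 0ℤ) →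
  ∀ (s : Fin n → ℤ) {A B : Cols n r} → (∀ j i → A j i ≡ B j i ℤ.+ s j ℤ.* x i) → F A ≡ F B
shear {zero}  alt x vx s eq = cong-≗ alt (λ ())
shear {suc n} {F = F} alt x vx s {A} {B} eq = begin
  F A
    ≡⟨ cong-≗ alt (λ j i → cong (λ v → v i) (cons-η A j)) ⟩
  F (A zero ◂ tail A)
    ≡⟨ shear (fix-first alt (A zero)) x (λ C j → vx (A zero ◂ C) (suc j)) (s ∘ suc) (eq ∘ suc) ⟩
  F (A zero ◂ tail B)
    ≡⟨ linear-first alt 1ℤ (s zero) (B zero) x (tail B)
         (λ i → trans (eq zero i) (cong (ℤ._+ s zero ℤ.* x i) (sym (ℤ.*-identityˡ (B zero i))))) ⟩
  1ℤ ℤ.* F (B zero ◂ tail B) ℤ.+ s zero ℤ.* F (x ◂ tail B)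
    ≡⟨ cong₂ ℤ._+_ (ℤ.*-identityˡ (F (B zero ◂ tail B)))
         (trans (cong (s zero ℤ.*_) (vx (x ◂ tail B) zero (λ i → refl))) (ℤ.*-zeroʳ (s zero))) ⟩
  F (B zero ◂ tail B) ℤ.+ 0ℤ
    ≡⟨ ℤ.+-identityʳ _ ⟩
  F (B zero ◂ tail B)
    ≡⟨ cong-≗ alt (λ j i → cong (λ v → v i) (sym (cons-η B j))) ⟩
  F B ∎
  where open ≡-Reasoning

-- The first column reaches place `k` by adjacent swaps. Only vanishing is tracked, so no sign has
-- to be computed.
vanish-insertAt : ∀ {n r} {F : Cols (suc n) r → ℤ} → Alternating F →
  ∀ x vs k → F (insertAt vs k x) ≡ 0ℤ → F (x ◂ vs) ≡ 0ℤ
vanish-insertAt alt x vs zero eq =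
  trans (cong-≗ alt λ { zero i → refl ; (suc j) i → refl }) eq
vanish-insertAt {suc n} {F = F} alt x vs (suc k) eq = begin
  F (x ◂ vs)
    ≡⟨ cong-≗ (fix-first alt x) (λ j i → cong (λ v → v i) (cons-η vs j)) ⟩
  F (x ◂ vs zero ◂ tail vs)
    ≡⟨ swap-first alt x (vs zero) (tail vs) ⟩
  ℤ.- F (vs zero ◂ x ◂ tail vs)
    ≡⟨ cong ℤ.-_ (vanish-insertAt (fix-first alt (vs zero)) x (tail vs) k
         (trans (cong-≗ alt λ { zero i → refl ; (suc j) i → refl }) eq)) ⟩
  0ℤ ∎
  where open ≡-Reasoning

insertAt-cong : ∀ {n} {X : Set} {u v : Fin n → X} k x → (∀ i → u i ≡ v i) →
  ∀ i → insertAt u k x i ≡ insertAt v k x i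
insertAt-cong {suc n} zero    x eq zero    = refl
insertAt-cong {suc n} zero    x eq (suc i) = eq i
insertAt-cong {suc n} (suc k) x eq zero    = eq zero
insertAt-cong {suc n} (suc k) x eq (suc i) = insertAt-cong k x (eq ∘ suc) i
insertAt-cong {zero}  zero    x eq zero    = refl

insertAt-unique : ∀ {n} {X : Set} {v : Fin n → X} {k x} {u : Fin (suc n) → X} →
  u k ≡ x → (∀ i → u (punchIn k i) ≡ v i) → ∀ i → insertAt v k x i ≡ u i
insertAt-unique {v = v} {k} {x} {u} uk up i with k ≟ i
... | yes refl = trans (insertAt-lookup v k x) (sym uk)
... | no  k≢i  = subst (λ i → insertAt v k x i ≡ u i) (punchIn-punchOut k≢i)
                   (trans (insertAt-punchIn v k x (punchOut k≢i)) (sym (up (punchOut k≢i))))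

-- Induction on the dimension. Expanding the first column in the standard basis reduces it to a
-- basis vector `Id k`, and a shear clears row `k` of the other columns. What remains is an
-- alternating form one dimension lower.
alternating-zero : ∀ {n} {F : Cols n n → ℤ} → Alternating F → F Id ≡ 0ℤ → ∀ A → F A ≡ 0ℤ
alternating-zero {zero}  alt F-Id A = trans (cong-≗ alt (λ ())) F-Id
alternating-zero {suc n} {F} alt F-Id A = begin
  F A
    ≡⟨ cong-≗ alt (λ j i → cong (λ v → v i) (cons-η A j)) ⟩
  F (A zero ◂ tail A)
    ≡⟨ linear-sum alt (A zero) Id (tail A) (λ i → sym (sum-Idʳ (A zero) i)) ⟩
  sumFin (λ k → A zero k ℤ.* F (Id k ◂ tail A))
    ≡⟨ sum-zero (λ k → trans (cong (A zero k ℤ.*_) (term k)) (ℤ.*-zeroʳ (A zero k))) ⟩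
  0ℤ ∎
  where
  open ≡-Reasoning
  -- `G k` borders a smaller matrix by the column `Id k` and, in the other columns, a row of zeros
  -- at `k`.
  G : Fin (suc n) → Cols n n → ℤ
  G k B = F (Id k ◂ λ j → insertAt (B j) k 0ℤ)
  insertAt-linear : ∀ {n} s t {x y z : Fin n → ℤ} k →
    (∀ i → z i ≡ s ℤ.* x i ℤ.+ t ℤ.* y i) → ∀ i →
    insertAt z k 0ℤ i ≡ s ℤ.* insertAt x k 0ℤ i ℤ.+ t ℤ.* insertAt y k 0ℤ i
  insertAt-linear s t {x} {y} k eq = insertAt-unique
    (trans (cong₂ (λ a b → s ℤ.* a ℤ.+ t ℤ.* b) (insertAt-lookup x k 0ℤ) (insertAt-lookup y k 0ℤ))
           (sym (zeros s t)))
    (λ i → trans (cong₂ (λ a b → s ℤ.* a ℤ.+ t ℤ.* b) (insertAt-punchIn x k 0ℤ i) (insertAt-punchIn y k 0ℤ i))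
                 (sym (eq i)))
    where
    zeros : ∀ s t → 0ℤ ≡ s ℤ.* 0ℤ ℤ.+ t ℤ.* 0ℤ
    zeros = solve-∀
  G-alt : ∀ k → Alternating (G k)
  G-alt k .cong-≗ eq = cong-≗ (fix-first alt (Id k)) (λ j → insertAt-cong k 0ℤ (eq j))
  G-alt k .linear c s t eq eqB eqC = linear (fix-first alt (Id k)) c s t
    (insertAt-linear s t k eq)
    (λ j j≢c → insertAt-cong k 0ℤ (eqB j j≢c))
    (λ j j≢c → insertAt-cong k 0ℤ (eqC j j≢c))
  G-alt k .vanish adj eq = vanish (fix-first alt (Id k)) adj (insertAt-cong k 0ℤ eq)
  G-Id : ∀ k → G k Id ≡ 0ℤ
  -- Moving `Id k` back to place `k` turns the bordered identity into the identity.
  G-Id k = vanish-insertAt alt (Id k) _ k (trans (cong-≗ alt pointwise) F-Id)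
    where
    pointwise : ∀ j i → insertAt (λ j → insertAt (Id j) k 0ℤ) k (Id k) j i ≡ Id j i
    pointwise j i with k ≟ j
    ... | yes refl = cong (λ v → v i) (insertAt-lookup (λ j → insertAt (Id j) k 0ℤ) k (Id k))
    ... | no  k≢j  = subst (λ j → insertAt (λ j → insertAt (Id j) k 0ℤ) k (Id k) j i ≡ Id j i)
      (punchIn-punchOut k≢j)
      (trans (cong (λ v → v i) (insertAt-punchIn (λ j → insertAt (Id j) k 0ℤ) k (Id k) j′))
             (insertAt-unique {v = Id j′} {k} {u = Id (punchIn k j′)}
               (Id-off (punchInᵢ≢i k j′)) (Id-punchIn k j′) i))
      where j′ = punchOut k≢j
  term : ∀ k → F (Id k ◂ tail A) ≡ 0ℤ
  term k = begin
    F (Id k ◂ tail A)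
      ≡⟨ shear (fix-first alt (Id k)) (Id k) (λ vs j → vanish-repeat alt (Id k) vs j)
           (λ j → A (suc j) k) clear ⟩
    G k (λ j i → A (suc j) (punchIn k i))
      ≡⟨ alternating-zero (G-alt k) (G-Id k) _ ⟩
    0ℤ ∎
    where
    clear : ∀ j i → A (suc j) i ≡
      insertAt (λ i → A (suc j) (punchIn k i)) k 0ℤ i ℤ.+ A (suc j) k ℤ.* Id k i
    clear j i with k ≟ i
    ... | yes refl = begin
      A (suc j) k
        ≡⟨ trans (ℤ.+-identityˡ _) (ℤ.*-identityʳ _) ⟨
      0ℤ ℤ.+ A (suc j) k ℤ.* 1ℤ
        ≡⟨ cong₂ (λ a b → a ℤ.+ A (suc j) k ℤ.* b)
             (insertAt-lookup (λ i → A (suc j) (punchIn k i)) k 0ℤ) (Id-diag k) ⟨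
      _ ∎
    ... | no k≢i = subst (λ i → A (suc j) i ≡
        insertAt (λ i → A (suc j) (punchIn k i)) k 0ℤ i ℤ.+ A (suc j) k ℤ.* Id k i)
      (punchIn-punchOut k≢i) (begin
        A (suc j) (punchIn k i′)
          ≡⟨ trans (cong (λ a → A (suc j) (punchIn k i′) ℤ.+ a) (ℤ.*-zeroʳ (A (suc j) k))) (ℤ.+-identityʳ _) ⟨
        A (suc j) (punchIn k i′) ℤ.+ A (suc j) k ℤ.* 0ℤ
          ≡⟨ cong₂ (λ a b → a ℤ.+ A (suc j) k ℤ.* b)
               (insertAt-punchIn (λ i → A (suc j) (punchIn k i)) k 0ℤ i′)
               (Id-off (punchInᵢ≢i k i′ ∘ sym)) ⟨
        _ ∎)
      where i′ = punchOut k≢i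

-- Multiplicativity of the determinant

det-cong : ∀ {n} {M M′ : Fin n → Fin n → ℤ} → (∀ i j → M i j ≡ M′ i j) → det M ≡ det M′
det-cong {zero}  eq = refl
det-cong {suc n} eq = sum-cong λ k → cong (sign k ℤ.*_)
  (cong₂ ℤ._*_ (eq zero k) (det-cong λ i j → eq (suc i) (punchIn k j)))

-- In the expansion along the first row, the term at `c` is linear through its entry while its minor
-- avoids column `c`; every other term is linear through its minor, by induction.
det-linear : ∀ {n} c s t {M M′ M″ : Fin n → Fin n → ℤ} →
  (∀ i → M i c ≡ s ℤ.* M′ i c ℤ.+ t ℤ.* M″ i c) →
  (∀ j → j ≢ c → ∀ i → M i j ≡ M′ i j) →
  (∀ j → j ≢ c → ∀ i → M i j ≡ M″ i j) →
  det M ≡ s ℤ.* det M′ ℤ.+ t ℤ.* det M″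
det-linear {suc n} c s t {M} {M′} {M″} eq eq′ eq″ = sum-linear s t term
  where
  minor : (Fin (suc n) → Fin (suc n) → ℤ) → Fin (suc n) → ℤ
  minor M k = det (λ i j → M (suc i) (punchIn k j))
  entry : ∀ e s t a b d → e ℤ.* ((s ℤ.* a ℤ.+ t ℤ.* b) ℤ.* d) ≡
    s ℤ.* (e ℤ.* (a ℤ.* d)) ℤ.+ t ℤ.* (e ℤ.* (b ℤ.* d))
  entry = solve-∀
  minors : ∀ e s t a b d → e ℤ.* (a ℤ.* (s ℤ.* b ℤ.+ t ℤ.* d)) ≡
    s ℤ.* (e ℤ.* (a ℤ.* b)) ℤ.+ t ℤ.* (e ℤ.* (a ℤ.* d))
  minors = solve-∀
  term : ∀ k → sign k ℤ.* (M zero k ℤ.* minor M k) ≡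
    s ℤ.* (sign k ℤ.* (M′ zero k ℤ.* minor M′ k)) ℤ.+ t ℤ.* (sign k ℤ.* (M″ zero k ℤ.* minor M″ k))
  term k with k ≟ c
  ... | yes refl = begin
    sign k ℤ.* (M zero k ℤ.* minor M k)
      ≡⟨ cong (λ a → sign k ℤ.* (a ℤ.* minor M k)) (eq zero) ⟩
    sign k ℤ.* ((s ℤ.* M′ zero k ℤ.+ t ℤ.* M″ zero k) ℤ.* minor M k)
      ≡⟨ entry (sign k) s t (M′ zero k) (M″ zero k) (minor M k) ⟩
    s ℤ.* (sign k ℤ.* (M′ zero k ℤ.* minor M k)) ℤ.+ t ℤ.* (sign k ℤ.* (M″ zero k ℤ.* minor M k))
      ≡⟨ cong₂ (λ a b → s ℤ.* (sign k ℤ.* (M′ zero k ℤ.* a)) ℤ.+ t ℤ.* (sign k ℤ.* (M″ zero k ℤ.* b)))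
           (det-cong λ i j → eq′ (punchIn k j) (punchInᵢ≢i k j) (suc i))
           (det-cong λ i j → eq″ (punchIn k j) (punchInᵢ≢i k j) (suc i)) ⟩
    _ ∎
    where open ≡-Reasoning
  ... | no k≢c = begin
    sign k ℤ.* (M zero k ℤ.* minor M k)
      ≡⟨ cong (λ a → sign k ℤ.* (M zero k ℤ.* a)) (det-linear c′ s t column
           (other {M′} eq′) (other {M″} eq″)) ⟩
    sign k ℤ.* (M zero k ℤ.* (s ℤ.* minor M′ k ℤ.+ t ℤ.* minor M″ k))
      ≡⟨ minors (sign k) s t (M zero k) (minor M′ k) (minor M″ k) ⟩
    s ℤ.* (sign k ℤ.* (M zero k ℤ.* minor M′ k)) ℤ.+ t ℤ.* (sign k ℤ.* (M zero k ℤ.* minor M″ k))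
      ≡⟨ cong₂ (λ a b → s ℤ.* (sign k ℤ.* (a ℤ.* minor M′ k)) ℤ.+ t ℤ.* (sign k ℤ.* (b ℤ.* minor M″ k)))
           (eq′ k k≢c zero) (eq″ k k≢c zero) ⟩
    _ ∎
    where
    open ≡-Reasoning
    c′ = punchOut k≢c
    column : ∀ i → M (suc i) (punchIn k c′) ≡
      s ℤ.* M′ (suc i) (punchIn k c′) ℤ.+ t ℤ.* M″ (suc i) (punchIn k c′)
    column i rewrite punchIn-punchOut k≢c = eq (suc i)
    other : ∀ {N : Fin (suc n) → Fin (suc n) → ℤ} → (∀ j → j ≢ c → ∀ i → M i j ≡ N i j) → ∀ j → j ≢ c′ → ∀ i →
      M (suc i) (punchIn k j) ≡ N (suc i) (punchIn k j)
    other eqN j j≢c′ i = eqN (punchIn k j)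
      (λ eqc → j≢c′ (punchIn-injective k j c′ (trans eqc (sym (punchIn-punchOut k≢c))))) (suc i)

sign-adjacent : ∀ {n} {c d : Fin n} → Adjacent c d → sign d ≡ ℤ.- sign c
sign-adjacent first       = refl
sign-adjacent (later adj) = cong ℤ.-_ (sign-adjacent adj)

sum-adjacent : ∀ {n} {c d : Fin n} → Adjacent c d → {f : Fin n → ℤ} →
  f c ℤ.+ f d ≡ 0ℤ → (∀ k → k ≢ c → k ≢ d → f k ≡ 0ℤ) → sumFin f ≡ 0ℤ
sum-adjacent first {f} cancel rest = begin
  f zero ℤ.+ (f (suc zero) ℤ.+ sumFin (λ k → f (suc (suc k))))
    ≡⟨ ℤ.+-assoc (f zero) _ _ ⟨
  f zero ℤ.+ f (suc zero) ℤ.+ sumFin (λ k → f (suc (suc k)))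
    ≡⟨ cong₂ ℤ._+_ cancel (sum-zero (λ k → rest (suc (suc k)) (λ ()) (λ ()))) ⟩
  0ℤ ∎
  where open ≡-Reasoning
sum-adjacent (later adj) cancel rest = cong₂ ℤ._+_ (rest zero (λ ()) (λ ()))
  (sum-adjacent adj cancel (λ k k≢c k≢d → rest (suc k)
    (k≢c ∘ λ { refl → refl }) (k≢d ∘ λ { refl → refl })))

punchIn-adjacent : ∀ {n} {c d : Fin (suc n)} → Adjacent c d → {X : Set} (f : Fin (suc n) → X) →
  f c ≡ f d → ∀ j → f (punchIn c j) ≡ f (punchIn d j)
punchIn-adjacent first       f eq zero    = sym eq
punchIn-adjacent first       f eq (suc j) = refl
punchIn-adjacent (later {suc _} adj) f eq zero    = refl
punchIn-adjacent (later {suc _} adj) f eq (suc j) = punchIn-adjacent adj (f ∘ suc) eq j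

adjacent-punchIn : ∀ {n} {c d : Fin (suc n)} → Adjacent c d → ∀ k → k ≢ c → k ≢ d →
  ∃₂ λ c′ d′ → Adjacent c′ d′ × punchIn k c′ ≡ c × punchIn k d′ ≡ d
adjacent-punchIn first zero k≢c k≢d = ⊥-elim (k≢c refl)
adjacent-punchIn first (suc zero) k≢c k≢d = ⊥-elim (k≢d refl)
adjacent-punchIn {suc (suc n)} first (suc (suc k)) k≢c k≢d = zero , suc zero , first , refl , refl
adjacent-punchIn (later {c = c} {d} adj) zero k≢c k≢d = c , d , adj , refl , refl
adjacent-punchIn {suc n} (later adj) (suc k) k≢c k≢d
  with adjacent-punchIn adj k (k≢c ∘ cong suc) (k≢d ∘ cong suc)
... | c′ , d′ , adj′ , eqc , eqd = suc c′ , suc d′ , later adj′ , cong suc eqc , cong suc eqd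

-- The terms at `c` and `d` have equal entries, equal minors and opposite signs. Every other minor
-- still has two equal neighbouring columns.
det-vanish : ∀ {n} {c d : Fin n} → Adjacent c d → {M : Fin n → Fin n → ℤ} →
  (∀ i → M i c ≡ M i d) → det M ≡ 0ℤ
det-vanish {suc n} {c} {d} adj {M} eq = sum-adjacent adj cancel rest
  where
  open ≡-Reasoning
  minor : Fin (suc n) → ℤ
  minor k = det (λ i j → M (suc i) (punchIn k j))
  opposite : ∀ e a b → e ℤ.* (a ℤ.* b) ℤ.+ (ℤ.- e) ℤ.* (a ℤ.* b) ≡ 0ℤ
  opposite = solve-∀
  cancel : sign c ℤ.* (M zero c ℤ.* minor c) ℤ.+ sign d ℤ.* (M zero d ℤ.* minor d) ≡ 0ℤ
  cancel = begin
    sign c ℤ.* (M zero c ℤ.* minor c) ℤ.+ sign d ℤ.* (M zero d ℤ.* minor d)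
      ≡⟨ cong₂ (λ e m → sign c ℤ.* (M zero c ℤ.* minor c) ℤ.+ e ℤ.* m) (sign-adjacent adj)
           (cong₂ ℤ._*_ (sym (eq zero))
             (det-cong λ i j → sym (punchIn-adjacent adj (M (suc i)) (eq (suc i)) j))) ⟩
    sign c ℤ.* (M zero c ℤ.* minor c) ℤ.+ (ℤ.- sign c) ℤ.* (M zero c ℤ.* minor c)
      ≡⟨ opposite (sign c) (M zero c) (minor c) ⟩
    0ℤ ∎
  rest : ∀ k → k ≢ c → k ≢ d → sign k ℤ.* (M zero k ℤ.* minor k) ≡ 0ℤ
  rest k k≢c k≢d with adjacent-punchIn adj k k≢c k≢d
  ... | c′ , d′ , adj′ , refl , refl = begin
    sign k ℤ.* (M zero k ℤ.* minor k)
      ≡⟨ cong (λ m → sign k ℤ.* (M zero k ℤ.* m)) (det-vanish adj′ (eq ∘ suc)) ⟩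
    sign k ℤ.* (M zero k ℤ.* 0ℤ)
      ≡⟨ cong (sign k ℤ.*_) (ℤ.*-zeroʳ (M zero k)) ⟩
    sign k ℤ.* 0ℤ
      ≡⟨ ℤ.*-zeroʳ (sign k) ⟩
    0ℤ ∎

detCols : ∀ {n} → Cols n n → ℤ
detCols A = det (λ i j → A j i)

detCols-alternating : ∀ {n} → Alternating (detCols {n})
detCols-alternating .cong-≗ eq = det-cong (λ i j → eq j i)
detCols-alternating .linear c s t eq eqB eqC = det-linear c s t eq eqB eqC
detCols-alternating .vanish adj eq = det-vanish adj eq

det-scalar : ∀ n c → det (λ (i j : Fin n) → c ℤ.* Id i j) ≡ c ℤ.^ n
det-scalar zero    c = refl
det-scalar (suc n) c = begin
  1ℤ ℤ.* (c ℤ.* 1ℤ ℤ.* D) ℤ.+ sumFin (λ k → sign (suc k) ℤ.* (c ℤ.* 0ℤ ℤ.* minor k))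
    ≡⟨ cong (λ a → 1ℤ ℤ.* (c ℤ.* 1ℤ ℤ.* D) ℤ.+ a) (sum-zero (λ k → zeros (sign (suc k)) c (minor k))) ⟩
  1ℤ ℤ.* (c ℤ.* 1ℤ ℤ.* D) ℤ.+ 0ℤ
    ≡⟨ ones c D ⟩
  c ℤ.* D
    ≡⟨ cong (c ℤ.*_) (det-scalar n c) ⟩
  c ℤ.* c ℤ.^ n ∎
  where
  open ≡-Reasoning
  D = det (λ (i j : Fin n) → c ℤ.* Id i j)
  minor : Fin n → ℤ
  minor k = det (λ (i j : Fin n) → c ℤ.* Id (suc i) (punchIn (suc k) j))
  zeros : ∀ e c m → e ℤ.* (c ℤ.* 0ℤ ℤ.* m) ≡ 0ℤ
  zeros = solve-∀
  ones : ∀ c d → 1ℤ ℤ.* (c ℤ.* 1ℤ ℤ.* d) ℤ.+ 0ℤ ≡ c ℤ.* d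
  ones = solve-∀

Id-sym : ∀ {n} (i j : Fin n) → Id i j ≡ Id j i
Id-sym zero    zero    = refl
Id-sym zero    (suc j) = refl
Id-sym (suc i) zero    = refl
Id-sym (suc i) (suc j) = Id-sym i j

det-Id : ∀ n → det (Id {n}) ≡ 1ℤ
det-Id n = trans (det-cong {n} {M′ = λ i j → 1ℤ ℤ.* Id i j} (λ i j → sym (ℤ.*-identityˡ (Id i j))))
                 (trans (det-scalar n 1ℤ) (ℤ.^-zeroˡ n))

infixl 7 _⊡_

_⊡_ : ∀ {n} → (Fin n → Fin n → ℤ) → (Fin n → Fin n → ℤ) → (Fin n → Fin n → ℤ)
(M ⊡ X) i j = sumFin (λ k → M i k ℤ.* X k j)

-- The difference of the two sides, as a form in the columns of X, is alternating and vanishes at Id.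
det-⊡ : ∀ {n} (M X : Fin n → Fin n → ℤ) → det (M ⊡ X) ≡ det M ℤ.* det X
det-⊡ {n} M X = ℤ.i-j≡0⇒i≡j (det (M ⊡ X)) (det M ℤ.* det X)
  (alternating-zero alt atId (λ j i → X i j))
  where
  open ≡-Reasoning
  F : Cols n n → ℤ
  F A = det (M ⊡ (λ i j → A j i)) ℤ.- det M ℤ.* detCols A
  combine : ∀ s t d a b a′ b′ →
    (s ℤ.* a ℤ.+ t ℤ.* b) ℤ.- d ℤ.* (s ℤ.* a′ ℤ.+ t ℤ.* b′) ≡
    s ℤ.* (a ℤ.- d ℤ.* a′) ℤ.+ t ℤ.* (b ℤ.- d ℤ.* b′)
  combine = solve-∀
  distribute : ∀ s t m a b → m ℤ.* (s ℤ.* a ℤ.+ t ℤ.* b) ≡ s ℤ.* (m ℤ.* a) ℤ.+ t ℤ.* (m ℤ.* b)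
  distribute = solve-∀
  alt : Alternating F
  alt .cong-≗ eq = cong₂ (λ a b → a ℤ.- det M ℤ.* b)
    (det-cong λ i j → sum-cong λ k → cong (M i k ℤ.*_) (eq j k))
    (cong-≗ detCols-alternating eq)
  alt .linear c s t {A} {B} {C} eq eqB eqC = trans
    (cong₂ (λ a b → a ℤ.- det M ℤ.* b)
      (det-linear c s t
        (λ i → sum-linear s t λ k →
          trans (cong (M i k ℤ.*_) (eq k)) (distribute s t (M i k) (B c k) (C c k)))
        (λ j j≢c i → sum-cong λ k → cong (M i k ℤ.*_) (eqB j j≢c k))
        (λ j j≢c i → sum-cong λ k → cong (M i k ℤ.*_) (eqC j j≢c k)))
      (linear detCols-alternating c s t eq eqB eqC))
    (combine s t (det M) (det (M ⊡ (λ i j → B j i))) (det (M ⊡ (λ i j → C j i))) (detCols B) (detCols C))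
  alt .vanish adj eq = trans
    (cong₂ (λ a b → a ℤ.- det M ℤ.* b)
      (det-vanish adj (λ i → sum-cong λ k → cong (M i k ℤ.*_) (eq k)))
      (vanish detCols-alternating adj eq))
    (cong (λ a → 0ℤ ℤ.- a) (ℤ.*-zeroʳ (det M)))
  atId : F Id ≡ 0ℤ
  atId = begin
    det (M ⊡ (λ i j → Id j i)) ℤ.- det M ℤ.* detCols (Id {n})
      ≡⟨ cong₂ (λ a b → a ℤ.- det M ℤ.* b)
           (det-cong {n} λ i j → trans (sum-cong λ k → cong (M i k ℤ.*_) (Id-sym j k)) (sum-Idʳ (M i) j))
           (trans (det-cong {n} λ i j → Id-sym j i) (det-Id n)) ⟩
    det M ℤ.- det M ℤ.* 1ℤ
      ≡⟨ cong (λ a → det M ℤ.- a) (ℤ.*-identityʳ (det M)) ⟩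
    det M ℤ.- det M
      ≡⟨ ℤ.+-inverseʳ (det M) ⟩
    0ℤ ∎

-- Products are compared through ab - a′b′ = (a - a′)b + a′(b - b′), with induction on the minors.
det-mod : ∀ {n m} {M M′ : Fin n → Fin n → ℤ} →
  (∀ i j → m ℤ∣.∣ M i j ℤ.- M′ i j) → m ℤ∣.∣ det M ℤ.- det M′
det-mod {zero}  div = ℤ∣.divides 0ℤ refl
det-mod {suc n} {m} {M} {M′} div = sum-mod {f = λ k → sign k ℤ.* (M zero k ℤ.* minor M k)} λ k →
  subst (m ℤ∣.∣_) (sym (expand (sign k) (M zero k) (M′ zero k) (minor M k) (minor M′ k)))
    (∣n⇒∣m*n (sign k) (∣m∣n⇒∣m+n (∣m⇒∣m*n (minor M k) (div zero k))
      (∣n⇒∣m*n (M′ zero k) (det-mod λ i j → div (suc i) (punchIn k j)))))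
  where
  minor : (Fin (suc n) → Fin (suc n) → ℤ) → Fin (suc n) → ℤ
  minor M k = det (λ i j → M (suc i) (punchIn k j))
  expand : ∀ e a a′ b b′ → e ℤ.* (a ℤ.* b) ℤ.- e ℤ.* (a′ ℤ.* b′) ≡
    e ℤ.* ((a ℤ.- a′) ℤ.* b ℤ.+ a′ ℤ.* (b ℤ.- b′))
  expand = solve-∀
  regroup : ∀ a b c d → (a ℤ.+ b) ℤ.- (c ℤ.+ d) ≡ (a ℤ.- c) ℤ.+ (b ℤ.- d)
  regroup = solve-∀
  sum-mod : ∀ {p} {f g : Fin p → ℤ} → (∀ k → m ℤ∣.∣ f k ℤ.- g k) → m ℤ∣.∣ sumFin f ℤ.- sumFin g
  sum-mod {zero}  d = ℤ∣.divides 0ℤ refl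
  sum-mod {suc p} {f} {g} d = subst (m ℤ∣.∣_)
    (sym (regroup (f zero) (sumFin (f ∘ suc)) (g zero) (sumFin (g ∘ suc))))
    (∣m∣n⇒∣m+n (d zero) (sum-mod (d ∘ suc)))

-- A zero column is a combination of itself with coefficients 0.
det-zero-column : ∀ {n} c {M : Fin n → Fin n → ℤ} → (∀ i → M i c ≡ 0ℤ) → det M ≡ 0ℤ
det-zero-column c eq = det-linear c 0ℤ 0ℤ eq (λ _ _ _ → refl) (λ _ _ _ → refl)

-- Classes of occurrences

%≡⇒∣ : ∀ m .{{_ : NonZero m}} a b → a % m ≡ b % m → + m ℤ∣.∣ + a ℤ.- + b
%≡⇒∣ m a b eq = ℤ∣.divides (+ (a / m) ℤ.- + (b / m)) (begin
  + a ℤ.- + b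
    ≡⟨ cong₂ (λ x y → x ℤ.- y) (split a) (split b) ⟩
  (+ (a % m) ℤ.+ + (a / m) ℤ.* + m) ℤ.- (+ (b % m) ℤ.+ + (b / m) ℤ.* + m)
    ≡⟨ cong (λ r → (r ℤ.+ + (a / m) ℤ.* + m) ℤ.- (+ (b % m) ℤ.+ + (b / m) ℤ.* + m)) (cong +_ eq) ⟩
  (+ (b % m) ℤ.+ + (a / m) ℤ.* + m) ℤ.- (+ (b % m) ℤ.+ + (b / m) ℤ.* + m)
    ≡⟨ cancel (+ (b % m)) (+ (a / m)) (+ (b / m)) (+ m) ⟩
  (+ (a / m) ℤ.- + (b / m)) ℤ.* + m ∎)
  where
  open ≡-Reasoning
  split : ∀ a → + a ≡ + (a % m) ℤ.+ + (a / m) ℤ.* + m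
  split a = trans (cong +_ (m≡m%n+[m/n]*n a m))
    (trans (ℤ.pos-+ (a % m) (a / m * m)) (cong (λ x → + (a % m) ℤ.+ x) (ℤ.pos-* (a / m) m)))
  cancel : ∀ r x y m → (r ℤ.+ x ℤ.* m) ℤ.- (r ℤ.+ y ℤ.* m) ≡ (x ℤ.- y) ℤ.* m
  cancel = solve-∀

-- Taking m = |D| shows that `D` divides `e`. If `D` were 0, the modulus e + 1 would divide `D` and
-- hence `e`.
divisor-bounds : ∀ D e .{{_ : NonZero e}} →
  (∀ m .{{_ : NonZero m}} → ∃[ y ] (+ m ℤ∣.∣ D ℤ.* y ℤ.- + e)) → 0 < ∣ D ∣ × ∣ D ∣ ≤ e
divisor-bounds D e mods = bounds ∣ D ∣ refl
  where
  cancel : ∀ a b → a ℤ.- (a ℤ.- b) ≡ b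
  cancel = solve-∀
  divisor≤e : ∀ m .{{_ : NonZero m}} → + m ℤ∣.∣ D → m ≤ e
  divisor≤e m m∣D with mods m
  ... | y , m∣ = ℕ∣.∣⇒≤ (ℤ∣.∣⇒∣ᵤ (subst (+ m ℤ∣.∣_) (cancel (D ℤ.* y) (+ e))
        (∣m∣n⇒∣m-n (∣m⇒∣m*n y m∣D) m∣)))
  bounds : ∀ n → ∣ D ∣ ≡ n → 0 < n × n ≤ e
  bounds zero    eq = ⊥-elim (ℕ.1+n≰n (divisor≤e (suc e)
    (ℤ∣.divides 0ℤ (trans (ℤ.∣i∣≡0⇒i≡0 eq) (sym (ℤ.*-zeroˡ (+ suc e)))))))
  bounds (suc n) eq = s≤s z≤n , divisor≤e (suc n) (subst (λ a → + a ℤ∣.∣ D) eq ℤ∣.∣m∣∣m)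

-- The prefix vectors at the occurrences of u meet at most K cosets of M ℤ^σ.
record Classified {σ} (w : Word σ) (M : Fin σ → Fin σ → ℤ) (u : List (Fin σ)) (K : ℕ) : Set where
  field
    class    : ∀ i → OccursAt w u i → Fin K
    coherent : ∀ {i i′} (p : OccursAt w u i) (p′ : OccursAt w u i′) → class i p ≡ class i′ p′ →
      ∃ λ (x : Fin σ → ℤ) → ∀ j →
        + prefCount w j i ℤ.- + prefCount w j i′ ≡ sumFin (λ k → M j k ℤ.* x k)

module _ {σ} {w : Word σ} (wd : WELLDOC w) {M : Fin σ → Fin σ → ℤ} {u : List (Fin σ)} {K : ℕ}
         (u∈w : IsFactor w u) (cl : Classified w M u K) where
  open Classified cl

  -- Of the residues t c with t ≤ K two occur in the same class, so (t − s) c ∈ M ℤ^σ mod m for some 0 < t − s ≤ K.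
  factorial-in-image : ∀ m .{{_ : NonZero m}} (c : Fin σ → ℕ) →
    ∃[ x ] (∀ j → + m ℤ∣.∣ sumFin (λ k → M j k ℤ.* x k) ℤ.- + (K !) ℤ.* + c j)
  factorial-in-image m c = combine (pigeonhole (ℕ.n<1+n K) (λ t → class (proj₁ (hit t)) (occ t)))
    where
    open ≡-Reasoning
    hit : ∀ (t : Fin (suc K)) → _
    hit t = wd m u u∈w (λ j → toℕ t * c j)
    occ : ∀ t → OccursAt w u (proj₁ (hit t))
    occ t = proj₁ (proj₂ (hit t))
    P : Fin (suc K) → Fin σ → ℤ
    P t j = + prefCount w j (proj₁ (hit t))
    res : ∀ t j → + m ℤ∣.∣ P t j ℤ.- + (toℕ t * c j)
    res t j = %≡⇒∣ m _ _ (proj₂ (proj₂ (hit t)) j)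
    pull : ∀ {n} (f x : Fin n → ℤ) a → sumFin (λ k → f k ℤ.* (a ℤ.* x k)) ≡ a ℤ.* sumFin (λ k → f k ℤ.* x k)
    pull f x a = trans (sum-linear a 0ℤ {h = x} (λ k → shuffle (f k) a (x k)))
                       (trans (cong (λ b → a ℤ.* sumFin (λ k → f k ℤ.* x k) ℤ.+ b) (ℤ.*-zeroˡ (sumFin x))) (ℤ.+-identityʳ _))
      where
      shuffle : ∀ f a x → f ℤ.* (a ℤ.* x) ≡ a ℤ.* (f ℤ.* x) ℤ.+ 0ℤ ℤ.* x
      shuffle = solve-∀
    regroup : ∀ q a b t s c → q ℤ.* (a ℤ.- b) ℤ.- q ℤ.* (t ℤ.- s) ℤ.* c ≡
      q ℤ.* ((a ℤ.- t ℤ.* c) ℤ.- (b ℤ.- s ℤ.* c))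
    regroup = solve-∀
    d∣K! : ∀ d → 0 < d → d ≤ K → d ℕ∣.∣ K !
    d∣K! (suc e) _ d≤K = ℕ∣.∣-trans (ℕ∣.m∣m*n (e !)) (ℕ∣.m≤n⇒m!∣n! d≤K)
    combine : (∃₂ λ s t → s Fin.< t × class _ (occ s) ≡ class _ (occ t)) →
      ∃[ x ] (∀ j → + m ℤ∣.∣ sumFin (λ k → M j k ℤ.* x k) ℤ.- + (K !) ℤ.* + c j)
    combine (s , t , s<t , eq) = (λ k → + q ℤ.* x k) , λ j →
      subst (+ m ℤ∣.∣_) (sym (identity j))
        (∣n⇒∣m*n (+ q) (∣m∣n⇒∣m-n (res t j) (res s j)))
      where
      same = coherent (occ t) (occ s) (sym eq)
      x = proj₁ same
      d = toℕ t ∸ toℕ s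
      div : d ℕ∣.∣ K !
      div = d∣K! d (ℕ.m<n⇒0<n∸m s<t) (ℕ.≤-trans (ℕ.m∸n≤m (toℕ t) (toℕ s)) (ℕ.≤-pred (toℕ<n t)))
      -- Multiplying by K!/d replaces the factor d = t - s, which depends on `m` and `c`, by the
      -- fixed K!.
      q = ℕ∣.quotient div
      K!≡ : + (K !) ≡ + q ℤ.* (+ toℕ t ℤ.- + toℕ s)
      K!≡ = trans (cong +_ (ℕ∣._∣_.equality div)) (trans (ℤ.pos-* q d) (cong (+ q ℤ.*_)
        (trans (sym (ℤ.⊖-≥ (ℕ.<⇒≤ s<t))) (sym (ℤ.m-n≡m⊖n (toℕ t) (toℕ s))))))
      identity : ∀ j → sumFin (λ k → M j k ℤ.* (+ q ℤ.* x k)) ℤ.- + (K !) ℤ.* + c j ≡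
        + q ℤ.* ((P t j ℤ.- + (toℕ t * c j)) ℤ.- (P s j ℤ.- + (toℕ s * c j)))
      identity j = begin
        sumFin (λ k → M j k ℤ.* (+ q ℤ.* x k)) ℤ.- + (K !) ℤ.* + c j
          ≡⟨ cong₂ (λ a b → a ℤ.- b ℤ.* + c j)
               (trans (pull (M j) x (+ q)) (cong (+ q ℤ.*_) (sym (proj₂ same j)))) K!≡ ⟩
        + q ℤ.* (P t j ℤ.- P s j) ℤ.- + q ℤ.* (+ toℕ t ℤ.- + toℕ s) ℤ.* + c j
          ≡⟨ regroup (+ q) (P t j) (P s j) (+ toℕ t) (+ toℕ s) (+ c j) ⟩
        + q ℤ.* ((P t j ℤ.- + toℕ t ℤ.* + c j) ℤ.- (P s j ℤ.- + toℕ s ℤ.* + c j))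
          ≡⟨ cong₂ (λ a b → + q ℤ.* ((P t j ℤ.- a) ℤ.- (P s j ℤ.- b)))
               (ℤ.pos-* (toℕ t) (c j)) (ℤ.pos-* (toℕ s) (c j)) ⟨
        _ ∎

  -- Solutions for the unit vectors are the columns of a matrix `X` with M X ≡ K! I modulo m; then
  -- determinants are taken.
  det-divides-mod : ∀ m .{{_ : NonZero m}} → ∃[ y ] (+ m ℤ∣.∣ det M ℤ.* y ℤ.- + ((K !) ^ σ))
  det-divides-mod m = det X , subst (+ m ℤ∣.∣_) (cong₂ ℤ._-_ (det-⊡ M X) (trans (det-scalar σ (+ (K !))) (pos-^ (K !) σ)))
      (det-mod {M = M ⊡ X} {λ i j → + (K !) ℤ.* Id i j} column)
    where
    unit : Fin σ → Fin σ → ℕ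
    unit j i = ∣ Id i j ∣
    X : Fin σ → Fin σ → ℤ
    X k j = proj₁ (factorial-in-image m (unit j)) k
    +∣Id∣ : ∀ {n} (i j : Fin n) → + ∣ Id i j ∣ ≡ Id i j
    +∣Id∣ zero    zero    = refl
    +∣Id∣ zero    (suc j) = refl
    +∣Id∣ (suc i) zero    = refl
    +∣Id∣ (suc i) (suc j) = +∣Id∣ i j
    column : ∀ i j → + m ℤ∣.∣ (M ⊡ X) i j ℤ.- + (K !) ℤ.* Id i j
    column i j = subst (λ e → + m ℤ∣.∣ (M ⊡ X) i j ℤ.- + (K !) ℤ.* e) (+∣Id∣ i j)
      (proj₂ (factorial-in-image m (unit j)) i)
    pos-^ : ∀ a n → (+ a) ℤ.^ n ≡ + (a ^ n)
    pos-^ a zero    = refl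
    pos-^ a (suc n) = trans (cong (+ a ℤ.*_) (pos-^ a n)) (sym (ℤ.pos-* a (a ^ n)))

  det-bounds : 0 < ∣ det M ∣ × ∣ det M ∣ ≤ (K !) ^ σ
  det-bounds = divisor-bounds (det M) ((K !) ^ σ) {{ℕ.m^n≢0 (K !) σ {{K ℕ.!≢0}}}} det-divides-mod

-- Windows and their desubstitutions

shift : ∀ {A : Set} → (ℕ → A) → ℕ → ℕ → A
shift f i t = f (i + t)

win : ∀ {A : Set} → (ℕ → A) → ℕ → ℕ → List A
win f i = applyUpTo (shift f i)

module _ {A : Set} where

  applyUpTo-cong : ∀ {f g : ℕ → A} n → (∀ t → t < n → f t ≡ g t) → applyUpTo f n ≡ applyUpTo g n
  applyUpTo-cong zero    eq = refl
  applyUpTo-cong (suc n) eq = cong₂ _∷_ (eq 0 (s≤s z≤n)) (applyUpTo-cong n (λ t t<n → eq (suc t) (s≤s t<n)))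

  applyUpTo-injective : ∀ {f g : ℕ → A} n → applyUpTo f n ≡ applyUpTo g n → ∀ t → t < n → f t ≡ g t
  applyUpTo-injective (suc n) eq zero    _         = List.∷-injectiveˡ eq
  applyUpTo-injective (suc n) eq (suc t) (s≤s t<n) = applyUpTo-injective n (List.∷-injectiveʳ eq) t t<n

  applyUpTo-+ : ∀ (f : ℕ → A) m n → applyUpTo f (m + n) ≡ applyUpTo f m ++ win f m n
  applyUpTo-+ f zero    n = refl
  applyUpTo-+ f (suc m) n = cong (f 0 ∷_) (applyUpTo-+ (f ∘ suc) m n)

  win-+ : ∀ (f : ℕ → A) i m n → win f i (m + n) ≡ win f i m ++ win f (i + m) n
  win-+ f i m n = trans (applyUpTo-+ (shift f i) m n)
    (cong (win f i m ++_) (applyUpTo-cong n (λ t _ → cong f (sym (ℕ.+-assoc i m t)))))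

  take-drop-applyUpTo : ∀ (f : ℕ → A) o n L → o + n ≤ L → take n (drop o (applyUpTo f L)) ≡ win f o n
  take-drop-applyUpTo f zero    zero    L       _       = refl
  take-drop-applyUpTo f zero    (suc n) (suc L) (s≤s p) = cong (f 0 ∷_) (take-drop-applyUpTo (f ∘ suc) zero n L p)
  take-drop-applyUpTo f (suc o) n       (suc L) (s≤s p) = take-drop-applyUpTo (f ∘ suc) o n L p

module _ {σ : ℕ} where

  startsWith-applyUpTo : ∀ (f : Word σ) n → StartsWith f (applyUpTo f n)
  startsWith-applyUpTo f zero    = tt
  startsWith-applyUpTo f (suc n) = refl , startsWith-applyUpTo (f ∘ suc) n

  startsWith⇒≡ : ∀ (f : Word σ) u → StartsWith f u → u ≡ applyUpTo f (length u)
  startsWith⇒≡ f []      _        = refl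
  startsWith⇒≡ f (x ∷ u) (eq , p) = cong₂ _∷_ (sym eq) (startsWith⇒≡ (f ∘ suc) u p)

  startsWith-++ : ∀ (f : Word σ) u {v} → StartsWith f (u ++ v) → StartsWith f u
  startsWith-++ f []      _        = tt
  startsWith-++ f (x ∷ u) (eq , p) = eq , startsWith-++ (f ∘ suc) u p

  occursAt-win : ∀ (w : Word σ) i n {i′} → OccursAt w (win w i n) i′ → win w i′ n ≡ win w i n
  occursAt-win w i n {i′} p = sym (subst (λ m → win w i n ≡ win w i′ m) (List.length-applyUpTo (shift w i) n)
    (startsWith⇒≡ (shift w i′) (win w i n) p))

  win-isFactor : ∀ (w : Word σ) i n → IsFactor w (win w i n)
  win-isFactor w i n = i , startsWith-applyUpTo (shift w i) n

  countL-∷ : ∀ (j x : Fin σ) u → + countL j (x ∷ u) ≡ Id x j ℤ.+ + countL j u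
  countL-∷ j x u with x ≟ j
  ... | yes refl rewrite Id-diag x   = refl
  ... | no  x≢j  rewrite Id-off x≢j = sym (ℤ.+-identityˡ _)

  countL-++ : ∀ (j : Fin σ) u v → countL j (u ++ v) ≡ countL j u + countL j v
  countL-++ j []      v = refl
  countL-++ j (x ∷ u) v with x ≟ j
  ... | yes _ = cong suc (countL-++ j u v)
  ... | no  _ = countL-++ j u v

  prefCount≡countL : ∀ (w : Word σ) j i → prefCount w j i ≡ countL j (applyUpTo w i)
  prefCount≡countL w j zero    = refl
  prefCount≡countL w j (suc i) = trans step
    (sym (trans (cong (countL j) (sym (List.applyUpTo-∷ʳ w i))) (countL-++ j (applyUpTo w i) [ w i ])))
    where
    step : prefCount w j (suc i) ≡ countL j (applyUpTo w i) + countL j [ w i ]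
    step with w i ≟ j
    ... | yes _ = trans (cong suc (prefCount≡countL w j i)) (ℕ.+-comm 1 _)
    ... | no  _ = trans (prefCount≡countL w j i) (sym (ℕ.+-identityʳ _))

  -- Each letter `x` of `u` adds column `x` of `Aφ g`, written as a sum against `Id x`.
  countL-concatMap : ∀ (g : Morphism σ) j u →
    + countL j (concatMap g u) ≡ sumFin (λ e → Aφ g j e ℤ.* + countL e u)
  countL-concatMap g j []      = sym (sum-zero (λ e → ℤ.*-zeroʳ (Aφ g j e)))
  countL-concatMap g j (x ∷ u) = begin
    + countL j (g x ++ concatMap g u)
      ≡⟨ cong +_ (countL-++ j (g x) (concatMap g u)) ⟩
    Aφ g j x ℤ.+ + countL j (concatMap g u)
      ≡⟨ cong₂ ℤ._+_ (sym (trans (sum-cong (λ e → cong (Aφ g j e ℤ.*_) (Id-sym x e))) (sum-Idʳ (Aφ g j) x)))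
           (countL-concatMap g j u) ⟩
    S₁ ℤ.+ S₂
      ≡⟨ cong₂ ℤ._+_ (ℤ.*-identityˡ S₁) (ℤ.*-identityˡ S₂) ⟨
    1ℤ ℤ.* S₁ ℤ.+ 1ℤ ℤ.* S₂
      ≡⟨ sum-linear 1ℤ 1ℤ (λ e → trans (cong (Aφ g j e ℤ.*_) (countL-∷ e x u))
           (distribute (Aφ g j e) (Id x e) (+ countL e u))) ⟨
    sumFin (λ e → Aφ g j e ℤ.* + countL e (x ∷ u)) ∎
    where
    open ≡-Reasoning
    S₁ = sumFin (λ e → Aφ g j e ℤ.* Id x e)
    S₂ = sumFin (λ e → Aφ g j e ℤ.* + countL e u)
    distribute : ∀ a b c → a ℤ.* (b ℤ.+ c) ≡ 1ℤ ℤ.* (a ℤ.* b) ℤ.+ 1ℤ ℤ.* (a ℤ.* c)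
    distribute = solve-∀

  concatMap-concatMap : ∀ (f g : Morphism σ) u →
    concatMap f (concatMap g u) ≡ concatMap (concatMap f ∘ g) u
  concatMap-concatMap f g []      = refl
  concatMap-concatMap f g (x ∷ u) =
    trans (List.concatMap-++ f (g x) (concatMap g u)) (cong (concatMap f (g x) ++_) (concatMap-concatMap f g u))

  power : Morphism σ → ℕ → Morphism σ
  power φ N e = iter φ N [ e ]

  iter≡concatMap : ∀ (φ : Morphism σ) N u → iter φ N u ≡ concatMap (power φ N) u
  iter≡concatMap φ zero    u = sym (List.concatMap-pure u)
  iter≡concatMap φ (suc N) u =
    trans (cong (concatMap φ) (iter≡concatMap φ N u)) (concatMap-concatMap φ (power φ N) u)

  iter-+ : ∀ (φ : Morphism σ) m n u → iter φ (m + n) u ≡ iter φ m (iter φ n u)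
  iter-+ φ zero    n u = refl
  iter-+ φ (suc m) n u = cong (concatMap φ) (iter-+ φ m n u)

  det-power : ∀ (φ : Morphism σ) N → det (Aφ (power φ N)) ≡ det (Aφ φ) ℤ.^ N
  det-power φ zero    = trans (det-cong (λ i j → trans (countL-∷ i j []) (trans (ℤ.+-identityʳ _) (Id-sym j i)))) (det-Id σ)
  det-power φ (suc N) = begin
    det (Aφ (power φ (suc N)))
      ≡⟨ det-cong (λ i j → countL-concatMap φ i (power φ N j)) ⟩
    det (Aφ φ ⊡ Aφ (power φ N))
      ≡⟨ det-⊡ (Aφ φ) (Aφ (power φ N)) ⟩
    det (Aφ φ) ℤ.* det (Aφ (power φ N))
      ≡⟨ cong (det (Aφ φ) ℤ.*_) (det-power φ N) ⟩
    det (Aφ φ) ℤ.* det (Aφ φ) ℤ.^ N ∎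
    where open ≡-Reasoning

-- The equation w = g(w), expressed by finite prefixes since `g` acts on lists.
Fixes : ∀ {σ} → Morphism σ → Word σ → Set
Fixes g w = ∀ k → StartsWith w (concatMap g (applyUpTo w k))

-- Iterates of the generating morphism.

module Generated {σ} {φ : Morphism σ} {w : Word σ} (gen : GeneratedBy w φ) where

  nonerasing : Nonerasing φ
  nonerasing = proj₁ gen
  a : Fin σ
  a = proj₁ (proj₂ gen)
  s = proj₁ (proj₂ (proj₂ gen))
  φa≡as : φ a ≡ a ∷ s
  φa≡as = proj₁ (proj₂ (proj₂ (proj₂ gen)))
  s≢[] : ¬ s ≡ []
  s≢[] = proj₁ (proj₂ (proj₂ (proj₂ (proj₂ gen))))
  starts : ∀ n → StartsWith w (iter φ n [ a ])
  starts = proj₂ (proj₂ (proj₂ (proj₂ (proj₂ gen))))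

  w0≡a : w 0 ≡ a
  w0≡a = proj₁ (starts 0)

  0<length : ∀ {u : List (Fin σ)} → ¬ u ≡ [] → 0 < length u
  0<length {[]}    u≢[] = ⊥-elim (u≢[] refl)
  0<length {_ ∷ _} u≢[] = s≤s z≤n

  length-φ* : ∀ u → length u ≤ length (concatMap φ u)
  length-φ* []      = z≤n
  length-φ* (x ∷ u) = ℕ.≤-trans (ℕ.+-mono-≤ (0<length (nonerasing x)) (length-φ* u))
    (ℕ.≤-reflexive (sym (List.length-++ (φ x))))

  -- The leading `a` becomes `a ∷ s`, at least two letters, and no other letter is erased.
  iter-grows : ∀ k → ∃[ l ] (k < l × iter φ k [ a ] ≡ applyUpTo w l)
  iter-grows zero    = 1 , s≤s z≤n , cong [_] (sym w0≡a)
  iter-grows (suc k) with iter-grows k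
  ... | suc l , s≤s k≤l , eq = length (iter φ (suc k) [ a ]) , grow , startsWith⇒≡ w _ (starts (suc k))
    where
    open ℕ.≤-Reasoning
    t = applyUpTo (w ∘ suc) l
    grow : suc (suc k) ≤ length (iter φ (suc k) [ a ])
    grow = begin
      suc (suc k)                              ≤⟨ s≤s (s≤s k≤l) ⟩
      suc (suc l)                              ≡⟨ cong (λ n → suc (suc n)) (List.length-applyUpTo (w ∘ suc) l) ⟨
      2 + length t                             ≤⟨ ℕ.+-mono-≤ (s≤s (0<length s≢[])) (length-φ* t) ⟩
      length (a ∷ s) + length (concatMap φ t)  ≡⟨ List.length-++ (a ∷ s) ⟨
      length ((a ∷ s) ++ concatMap φ t)        ≡⟨ cong (λ v → length (v ++ concatMap φ t)) (trans (cong φ w0≡a) φa≡as) ⟨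
      length (concatMap φ (applyUpTo w (suc l)))   ≡⟨ cong (length ∘ concatMap φ) eq ⟨
      length (iter φ (suc k) [ a ])            ∎

  -- The first `k` letters lie in φᵏ(a), so their image is a prefix of φᵏ⁺¹(a), itself a prefix of
  -- w.
  φ-fixes : Fixes φ w
  φ-fixes k with iter-grows k
  ... | l , k<l , eq = startsWith-++ w (concatMap φ (applyUpTo w k))
    (subst (StartsWith w) (begin
      iter φ (suc k) [ a ]
        ≡⟨ cong (concatMap φ) eq ⟩
      concatMap φ (applyUpTo w l)
        ≡⟨ cong (concatMap φ ∘ applyUpTo w) (ℕ.m+[n∸m]≡n (ℕ.<⇒≤ k<l)) ⟨
      concatMap φ (applyUpTo w (k + (l ∸ k)))
        ≡⟨ cong (concatMap φ) (applyUpTo-+ w k (l ∸ k)) ⟩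
      concatMap φ (applyUpTo w k ++ win w k (l ∸ k))
        ≡⟨ List.concatMap-++ φ (applyUpTo w k) _ ⟩
      concatMap φ (applyUpTo w k) ++ concatMap φ (win w k (l ∸ k)) ∎)
    (starts (suc k)))
    where open ≡-Reasoning

  iter-prefix : ∀ N k → ∃[ l ] iter φ N (applyUpTo w k) ≡ applyUpTo w l
  iter-prefix zero    k = k , refl
  iter-prefix (suc N) k with iter-prefix N k
  ... | l , eq = _ , trans (cong (concatMap φ) eq) (startsWith⇒≡ w _ (φ-fixes l))

  power-fixes : ∀ N → Fixes (power φ N) w
  power-fixes N k with iter-prefix N k
  ... | l , eq = subst (StartsWith w) (trans (sym eq) (iter≡concatMap φ N (applyUpTo w k))) (startsWith-applyUpTo w l)

  power-nonempty : ∀ N e → 0 < length (power φ N e)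
  power-nonempty zero    e = s≤s z≤n
  power-nonempty (suc N) e = ℕ.≤-trans (power-nonempty N e) (length-φ* (power φ N e))

-- Cutting a fixed word into the images of its letters.

module Blocks {σ} {g : Morphism σ} {w : Word σ} (fixes : Fixes g w) (nonempty : ∀ e → 0 < length (g e)) where

  cut : ℕ → ℕ
  cut k = length (concatMap g (applyUpTo w k))

  cut-+ : ∀ k n → cut (k + n) ≡ cut k + length (concatMap g (win w k n))
  cut-+ k n = trans (cong (length ∘ concatMap g) (applyUpTo-+ w k n))
    (trans (cong length (List.concatMap-++ g (applyUpTo w k) (win w k n))) (List.length-++ (concatMap g (applyUpTo w k))))

  cut-suc : ∀ k → cut (suc k) ≡ cut k + length (g (w k))
  cut-suc k = trans (cong cut (ℕ.+-comm 1 k)) (trans (cut-+ k 1)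
    (cong (λ v → cut k + length v) (trans (List.++-identityʳ _) (cong (g ∘ w) (ℕ.+-identityʳ k)))))

  record Position (i : ℕ) : Set where
    constructor position
    field
      block  : ℕ
      offset : ℕ
      split  : i ≡ cut block + offset
      inside : offset < length (g (w block))
  open Position public

  locate : ∀ i → Position i
  locate zero    = position 0 0 refl (nonempty (w 0))
  locate (suc i) with locate i
  ... | position k o eq o< with suc o <? length (g (w k))
  ...   | yes o+1< = position k (suc o) (trans (cong suc eq) (sym (ℕ.+-suc (cut k) o))) o+1<
  -- The block is used up; the next one is nonempty, so offset 0 lies inside it.
  ...   | no  o+1≮ = position (suc k) 0 (begin
    suc i                       ≡⟨ cong suc eq ⟩
    suc (cut k + o)             ≡⟨ ℕ.+-suc (cut k) o ⟨
    cut k + suc o               ≡⟨ cong (λ n → cut k + n) (ℕ.≤-antisym o< (ℕ.≮⇒≥ o+1≮)) ⟩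
    cut k + length (g (w k))    ≡⟨ cut-suc k ⟨
    cut (suc k)                 ≡⟨ ℕ.+-identityʳ _ ⟨
    cut (suc k) + 0             ∎) (nonempty (w (suc k)))
    where open ≡-Reasoning

  -- Both sides extend the prefix of length `cut k` to that of length `cut (k + n)`, and the common
  -- prefix cancels.
  image-win : ∀ k n → concatMap g (win w k n) ≡ win w (cut k) (length (concatMap g (win w k n)))
  image-win k n = List.++-cancelˡ (concatMap g (applyUpTo w k)) _ _ (begin
    concatMap g (applyUpTo w k) ++ concatMap g (win w k n)
      ≡⟨ List.concatMap-++ g (applyUpTo w k) (win w k n) ⟨
    concatMap g (applyUpTo w k ++ win w k n)
      ≡⟨ cong (concatMap g) (applyUpTo-+ w k n) ⟨
    concatMap g (applyUpTo w (k + n))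
      ≡⟨ startsWith⇒≡ w _ (fixes (k + n)) ⟩
    applyUpTo w (cut (k + n))
      ≡⟨ cong (applyUpTo w) (cut-+ k n) ⟩
    applyUpTo w (cut k + length (concatMap g (win w k n)))
      ≡⟨ applyUpTo-+ w (cut k) (length (concatMap g (win w k n))) ⟩
    applyUpTo w (cut k) ++ text
      ≡⟨ cong (_++ text) (startsWith⇒≡ w _ (fixes k)) ⟨
    concatMap g (applyUpTo w k) ++ text ∎)
    where
    open ≡-Reasoning
    text = win w (cut k) (length (concatMap g (win w k n)))

  win-in-image : ∀ k R o n → o + n ≤ length (concatMap g (win w k R)) →
    win w (cut k + o) n ≡ take n (drop o (concatMap g (win w k R)))
  win-in-image k R o n le = begin
    win w (cut k + o) n
      ≡⟨ applyUpTo-cong n (λ t _ → cong w (ℕ.+-assoc (cut k) o t)) ⟩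
    win (shift w (cut k)) o n
      ≡⟨ take-drop-applyUpTo (shift w (cut k)) o n _ le ⟨
    take n (drop o (win w (cut k) (length (concatMap g (win w k R)))))
      ≡⟨ cong (take n ∘ drop o) (image-win k R) ⟨
    _ ∎
    where open ≡-Reasoning

  letter-in-block : ∀ {k k′} → w k ≡ w k′ → ∀ t → t < length (g (w k)) → w (cut k + t) ≡ w (cut k′ + t)
  letter-in-block {k} {k′} eq t t< = applyUpTo-injective (length (g (w k)))
    (trans (sym (block-text k)) (trans (cong g eq) (trans (block-text k′)
      (cong (win w (cut k′) ∘ length ∘ g) (sym eq))))) t t<
    where
    image₁ : ∀ k → concatMap g (win w k 1) ≡ g (w k)
    image₁ k = trans (List.++-identityʳ _) (cong (g ∘ w) (ℕ.+-identityʳ k))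
    block-text : ∀ k → g (w k) ≡ win w (cut k) (length (g (w k)))
    block-text k = subst (λ u → u ≡ win w (cut k) (length u)) (image₁ k) (image-win k 1)

  -- The prefix is the image of the first `k` letters followed by part of one block, so only that
  -- part counts modulo the lattice spanned by the columns of `Aφ g`.
  parikh : ∀ k o j → + prefCount w j (cut k + o) ≡
    sumFin (λ e → Aφ g j e ℤ.* + prefCount w e k) ℤ.+ + countL j (win w (cut k) o)
  parikh k o j = begin
    + prefCount w j (cut k + o)
      ≡⟨ cong +_ (prefCount≡countL w j (cut k + o)) ⟩
    + countL j (applyUpTo w (cut k + o))
      ≡⟨ cong (+_ ∘ countL j) (applyUpTo-+ w (cut k) o) ⟩
    + countL j (applyUpTo w (cut k) ++ win w (cut k) o)
      ≡⟨ cong +_ (countL-++ j (applyUpTo w (cut k)) _) ⟩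
    + countL j (applyUpTo w (cut k)) ℤ.+ + countL j (win w (cut k) o)
      ≡⟨ cong (λ u → + countL j u ℤ.+ + countL j (win w (cut k) o)) (startsWith⇒≡ w _ (fixes k)) ⟨
    + countL j (concatMap g (applyUpTo w k)) ℤ.+ + countL j (win w (cut k) o)
      ≡⟨ cong (ℤ._+ + countL j (win w (cut k) o)) (trans (countL-concatMap g j (applyUpTo w k))
           (sum-cong λ e → cong (λ n → Aφ g j e ℤ.* + n) (sym (prefCount≡countL w e k)))) ⟩
    _ ∎
    where open ≡-Reasoning

  -- The two partial blocks are the same prefix of the same image, so their counts cancel; `x` is
  -- the difference of the prefix vectors at the two block indices.
  same-coset : ∀ {i i′} (p : Position i) (p′ : Position i′) → w (block p) ≡ w (block p′) → offset p ≡ offset p′ →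
    ∃ λ (x : Fin σ → ℤ) → ∀ j →
      + prefCount w j i ℤ.- + prefCount w j i′ ≡ sumFin (λ e → Aφ g j e ℤ.* x e)
  same-coset (position k o refl o<) (position k′ .o refl o<′) eq refl = x , λ j → begin
    + prefCount w j (cut k + o) ℤ.- + prefCount w j (cut k′ + o)
      ≡⟨ cong₂ ℤ._-_ (parikh k o j) (parikh k′ o j) ⟩
    (S j k ℤ.+ + countL j (win w (cut k) o)) ℤ.- (S j k′ ℤ.+ + countL j (win w (cut k′) o))
      ≡⟨ cong (λ u → (S j k ℤ.+ + countL j u) ℤ.- (S j k′ ℤ.+ + countL j (win w (cut k′) o)))
           (applyUpTo-cong o (λ t t<o → letter-in-block eq t (ℕ.<-trans t<o o<))) ⟩
    (S j k ℤ.+ + countL j (win w (cut k′) o)) ℤ.- (S j k′ ℤ.+ + countL j (win w (cut k′) o))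
      ≡⟨ cancel (S j k) (S j k′) _ ⟩
    1ℤ ℤ.* S j k ℤ.+ ℤ.- 1ℤ ℤ.* S j k′
      ≡⟨ sum-linear 1ℤ (ℤ.- 1ℤ) (λ e → distribute (Aφ g j e) _ _) ⟨
    sumFin (λ e → Aφ g j e ℤ.* x e) ∎
    where
    open ≡-Reasoning
    x : Fin σ → ℤ
    x e = + prefCount w e k ℤ.- + prefCount w e k′
    S : Fin σ → ℕ → ℤ
    S j k = sumFin (λ e → Aφ g j e ℤ.* + prefCount w e k)
    cancel : ∀ a b c → (a ℤ.+ c) ℤ.- (b ℤ.+ c) ≡ 1ℤ ℤ.* a ℤ.+ ℤ.- 1ℤ ℤ.* b
    cancel = solve-∀
    distribute : ∀ a b c → a ℤ.* (b ℤ.- c) ≡ 1ℤ ℤ.* (a ℤ.* b) ℤ.+ ℤ.- 1ℤ ℤ.* (a ℤ.* c)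
    distribute = solve-∀

-- Counting windows

filter-split : ∀ {A : Set} {P : A → Set} (P? : Decidable P) xs →
  length xs ≡ length (filter P? xs) + length (filter (¬? ∘ P?) xs)
filter-split P? []       = refl
filter-split P? (x ∷ xs) with P? x
... | yes _ = cong suc (filter-split P? xs)
... | no  _ = trans (cong suc (filter-split P? xs)) (sym (ℕ.+-suc _ _))

-- Averaging over disjoint fibres. If the fibre of the first index has more than `q` elements, it is
-- removed, and what is left of `xs` is still short enough for the remaining indices.
small-fibre : ∀ {A B I : Set} (_≟_ : DecidableEquality B) (f : A → B) (h : I → B) q is →
  AllPairs (λ i j → h i ≢ h j) is → ∀ xs → length xs < length is * suc q →
  ∃[ i ] (i ∈ is × ∃[ ys ] (length ys ≤ q × (∀ {x} → x ∈ xs → f x ≡ h i → x ∈ ys)))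
small-fibre _≟_ f h q (i ∷ is) (i# ∷ distinct) xs len with length (filter (λ x → f x ≟ h i) xs) ≤? q
... | yes few = i , here refl , _ , few , ∈-filter⁺ (λ x → f x ≟ h i)
... | no many with small-fibre _≟_ f h q is distinct (filter (λ x → ¬? (f x ≟ h i)) xs)
    (ℕ.+-cancelˡ-< (suc q) _ _ (ℕ.≤-<-trans (ℕ.+-monoˡ-≤ _ (ℕ.≰⇒> many))
      (subst (_< suc q + length is * suc q) (filter-split (λ x → f x ≟ h i) xs) len)))
...   | i′ , i′∈is , ys , few , covers = i′ , there i′∈is , ys , few , λ x∈xs eq →
  covers (∈-filter⁺ (λ x → ¬? (f x ≟ h i)) x∈xs (λ eq′ → All.lookup i# i′∈is (trans (sym eq′) eq))) eq

-- At most one of the pairwise distinct values equals `v`.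
length-remove : ∀ {B I : Set} (_≟_ : DecidableEquality B) (h : I → B) v is →
  AllPairs (λ i j → h i ≢ h j) is →
  length is ≤ suc (length (filter (λ i → ¬? (h i ≟ v)) is))
length-remove _≟_ h v []       []            = z≤n
length-remove _≟_ h v (i ∷ is) (i# ∷ distinct) with h i ≟ v
... | yes refl = s≤s (ℕ.≤-reflexive (sym (cong length
  (List.filter-all (λ i → ¬? (h i ≟ v)) (All.map (λ hi≢hj hj≡hi → hi≢hj (sym hj≡hi)) i#)))))
... | no  _    = s≤s (length-remove _≟_ h v is distinct)

length-cartesianProductWith : ∀ {A B C : Set} (f : A → B → C) xs ys →
  length (cartesianProductWith f xs ys) ≡ length xs * length ys
length-cartesianProductWith f []       ys = refl
length-cartesianProductWith f (x ∷ xs) ys = trans (List.length-++ (map (f x) ys))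
  (cong₂ _+_ (List.length-map (f x) ys) (length-cartesianProductWith f xs ys))

words : ∀ σ → ℕ → List (List (Fin σ))
words σ zero    = [ [] ]
words σ (suc n) = cartesianProductWith _∷_ (allFin σ) (words σ n)

∈-words : ∀ {σ} (f : Word σ) n → applyUpTo f n ∈ words σ n
∈-words f zero    = here refl
∈-words f (suc n) = ∈-cartesianProductWith⁺ _∷_ (∈-allFin (f 0)) (∈-words (f ∘ suc) n)

bounded : ∀ {n} (f : Fin n → ℕ) → ∃[ B ] (∀ e → f e ≤ B)
bounded {zero}  f = 0 , λ ()
bounded {suc n} f with bounded (f ∘ suc)
... | B , f≤B = f zero + B , λ { zero → ℕ.m≤m+n (f zero) B ; (suc e) → ℕ.≤-trans (f≤B e) (ℕ.m≤n+m B (f zero)) }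

n<m^n : ∀ m n → 2 ≤ m → n < m ^ n
n<m^n m zero    2≤m = s≤s z≤n
n<m^n m (suc n) 2≤m = begin-strict
  suc n              ≤⟨ n<m^n m n 2≤m ⟩
  m ^ n              <⟨ ℕ.m<m+n (m ^ n) (ℕ.≤-trans (s≤s z≤n) (n<m^n m n 2≤m)) ⟩
  m ^ n + m ^ n      ≡⟨ cong (λ k → m ^ n + k) (ℕ.+-identityʳ (m ^ n)) ⟨
  2 * m ^ n          ≤⟨ ℕ.*-monoˡ-≤ (m ^ n) 2≤m ⟩
  m * m ^ n          ∎
  where open ℕ.≤-Reasoning

prefCount-periodic : ∀ {σ} {w : Word σ} q → (∀ t → w (q + t) ≡ w t) → ∀ j t →
  prefCount w j (q + t) ≡ prefCount w j q + prefCount w j t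
prefCount-periodic {w = w} q per j t = begin
  prefCount w j (q + t)
    ≡⟨ prefCount≡countL w j (q + t) ⟩
  countL j (applyUpTo w (q + t))
    ≡⟨ cong (countL j) (applyUpTo-+ w q t) ⟩
  countL j (applyUpTo w q ++ win w q t)
    ≡⟨ countL-++ j (applyUpTo w q) (win w q t) ⟩
  countL j (applyUpTo w q) + countL j (win w q t)
    ≡⟨ cong (λ v → countL j (applyUpTo w q) + countL j v) (applyUpTo-cong t (λ s _ → per s)) ⟩
  countL j (applyUpTo w q) + countL j (applyUpTo w t)
    ≡⟨ cong₂ _+_ (prefCount≡countL w j q) (prefCount≡countL w j t) ⟨
  prefCount w j q + prefCount w j t ∎
  where open ≡-Reasoning

-- The prefix vectors of a q-periodic word lie in q cosets of a cyclic group, the column space of a singular matrix.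
periodic⇒¬WELLDOC : ∀ {σ} {w : Word (suc (suc σ))} q .{{_ : NonZero q}} →
  (∀ t → w (q + t) ≡ w t) → ¬ WELLDOC w
periodic⇒¬WELLDOC {σ} {w} q per wd = ℕ.<-irrefl refl
  (subst (0 <_) (cong ∣_∣ (det-zero-column (suc zero) {M} (λ _ → refl))) (proj₁ (det-bounds wd (0 , tt) classified)))
  where
  open ≡-Reasoning
  -- Column 0 is the Parikh vector of one period. A second letter exists, so there is also a zero
  -- column and the determinant is 0.
  M : Fin (suc (suc σ)) → Fin (suc (suc σ)) → ℤ
  M j zero    = + prefCount w j q
  M j (suc _) = 0ℤ
  multiple : ∀ j s t → prefCount w j (t + s * q) ≡ prefCount w j t + s * prefCount w j q
  multiple j zero    t = trans (cong (prefCount w j) (ℕ.+-identityʳ t)) (sym (ℕ.+-identityʳ _))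
  multiple j (suc s) t = begin
    prefCount w j (t + (q + s * q))
      ≡⟨ cong (prefCount w j) (swap t q (s * q)) ⟩
    prefCount w j (q + (t + s * q))
      ≡⟨ prefCount-periodic q per j (t + s * q) ⟩
    prefCount w j q + prefCount w j (t + s * q)
      ≡⟨ cong (λ n → prefCount w j q + n) (multiple j s t) ⟩
    prefCount w j q + (prefCount w j t + s * prefCount w j q)
      ≡⟨ swap (prefCount w j q) (prefCount w j t) _ ⟩
    prefCount w j t + (prefCount w j q + s * prefCount w j q) ∎
    where
    swap : ∀ a b c → a + (b + c) ≡ b + (a + c)
    swap a b c = trans (sym (ℕ.+-assoc a b c)) (trans (cong (λ n → n + c) (ℕ.+-comm a b)) (ℕ.+-assoc b a c))
  split : ∀ j i → + prefCount w j i ≡ + prefCount w j (i % q) ℤ.+ + (i / q) ℤ.* + prefCount w j q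
  split j i = trans (cong (λ n → + n) (trans (cong (prefCount w j) (m≡m%n+[m/n]*n i q)) (multiple j (i / q) (i % q))))
    (trans (ℤ.pos-+ (prefCount w j (i % q)) _) (cong (λ n → + prefCount w j (i % q) ℤ.+ n) (ℤ.pos-* (i / q) _)))
  difference : ∀ r s s′ p → (r ℤ.+ s ℤ.* p) ℤ.- (r ℤ.+ s′ ℤ.* p) ≡ p ℤ.* (s ℤ.- s′) ℤ.+ 0ℤ
  difference = solve-∀
  classified : Classified w M [] q
  classified .Classified.class i _ = fromℕ< (m%n<n i q)
  -- The other columns of `M` being zero, only the coordinate at `zero` matters and a constant
  -- vector serves.
  classified .Classified.coherent {i} {i′} _ _ same = (λ _ → + (i / q) ℤ.- + (i′ / q)) , λ j → begin
    + prefCount w j i ℤ.- + prefCount w j i′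
      ≡⟨ cong₂ ℤ._-_ (split j i) (split j i′) ⟩
    (+ prefCount w j (i % q) ℤ.+ + (i / q) ℤ.* + prefCount w j q) ℤ.-
    (+ prefCount w j (i′ % q) ℤ.+ + (i′ / q) ℤ.* + prefCount w j q)
      ≡⟨ cong (λ r → (+ prefCount w j r ℤ.+ + (i / q) ℤ.* + prefCount w j q) ℤ.-
           (+ prefCount w j (i′ % q) ℤ.+ + (i′ / q) ℤ.* + prefCount w j q))
           (fromℕ<-injective (i % q) (i′ % q) (m%n<n i q) (m%n<n i′ q) same) ⟩
    (+ prefCount w j (i′ % q) ℤ.+ + (i / q) ℤ.* + prefCount w j q) ℤ.-
    (+ prefCount w j (i′ % q) ℤ.+ + (i′ / q) ℤ.* + prefCount w j q)
      ≡⟨ difference (+ prefCount w j (i′ % q)) (+ (i / q)) (+ (i′ / q)) (+ prefCount w j q) ⟩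
    + prefCount w j q ℤ.* (+ (i / q) ℤ.- + (i′ / q)) ℤ.+ 0ℤ
      ≡⟨ cong (λ r → + prefCount w j q ℤ.* (+ (i / q) ℤ.- + (i′ / q)) ℤ.+ r)
           (sum-zero {suc σ} (λ k → ℤ.*-zeroˡ (+ (i / q) ℤ.- + (i′ / q)))) ⟨
    _ ∎

module _ {σ} {w : Word σ} where

  win-injective : ∀ i j n → win w i n ≡ win w j n → ∀ t → t < n → w (i + t) ≡ w (j + t)
  win-injective i j = applyUpTo-injective {f = shift w i} {shift w j}

  win-init : ∀ i j n → win w i (suc n) ≡ win w j (suc n) → win w i n ≡ win w j n
  win-init i j n eq = applyUpTo-cong n (λ t t<n → win-injective i j (suc n) eq t (ℕ.m<n⇒m<1+n t<n))

  -- At position 0 all counts are 0, so asking for odd counts forces a later occurrence of the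
  -- prefix; `j` supplies a count to test.
  recurs : WELLDOC w → Fin σ → ∀ n → ∃[ q ] (NonZero q × win w q n ≡ applyUpTo w n)
  recurs wd j n with wd 2 (applyUpTo w n) (win-isFactor w 0 n) (λ _ → 1)
  ... | zero  , _   , odd = contradiction (odd j) λ ()
  ... | suc q , occ , _   = suc q , _ , occursAt-win w 0 n occ

  -- An odd count is nonzero, so searching back through the prefix finds `e`.
  letter-occurs : WELLDOC w → ∀ e → ∃[ i ] w i ≡ e
  letter-occurs wd e with wd 2 [] (0 , tt) (λ _ → 1)
  ... | i , _ , odd = search i (λ eq → contradiction (trans (sym (odd e)) (cong (_% 2) eq)) λ ())
    where
    search : ∀ i → prefCount w e i ≢ 0 → ∃[ i ] w i ≡ e
    search zero    ≢0 = ⊥-elim (≢0 refl)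
    search (suc i) ≢0 with w i ≟ e
    ... | yes eq = i , eq
    ... | no  _  = search i ≢0

_≟L_ : ∀ {σ} → DecidableEquality (List (Fin σ))
_≟L_ = List.≡-dec _≟_

-- Right special factors and the number of windows.

module _ {σ} {w : Word (suc (suc σ))} (wd : WELLDOC w) where

  -- Otherwise every window of length `n` determines the next letter. As the initial window recurs
  -- at some q > 0, w would then be q-periodic. Double negation suffices because the final goal is
  -- `⊥`.
  right-special : ∀ n → ¬ ¬ (∃₂ λ p p′ → win w p n ≡ win w p′ n × w (p + n) ≢ w (p′ + n))
  right-special n none with recurs wd zero n
  ... | q , q≢0 , rec = periodic⇒¬WELLDOC q {{q≢0}} periodic wd
    where
    determined : ∀ p p′ → win w p n ≡ win w p′ n → w (p + n) ≡ w (p′ + n)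
    determined p p′ eq = decidable-stable (w (p + n) ≟ w (p′ + n)) (λ neq → none (p , p′ , eq , neq))
    periodic : ∀ t → w (q + t) ≡ w t
    periodic = <-rec _ step
      where
      step : ∀ t → (∀ {s} → s < t → w (q + s) ≡ w s) → w (q + t) ≡ w t
      step t ih with t <? n
      ... | yes t<n = applyUpTo-injective n rec t t<n
      ... | no  t≮n = subst (λ t → w (q + t) ≡ w t) (ℕ.m∸n+n≡m n≤t)
        (trans (cong w (sym (ℕ.+-assoc q r n))) (determined (q + r) r
          (applyUpTo-cong n λ s s<n → trans (cong w (ℕ.+-assoc q r s))
            (ih (subst (r + s <_) (ℕ.m∸n+n≡m n≤t) (ℕ.+-monoʳ-< r s<n))))))
        where
        n≤t = ℕ.≮⇒≥ t≮n
        r = t ∸ n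

  -- Morse–Hedlund: each right special factor contributes one more window when the length grows by one.
  distinct-windows : ∀ n → ¬ ¬ (∃[ is ] (AllPairs (λ i j → win w i n ≢ win w j n) is × n < length is))
  distinct-windows zero    none = none ([ 0 ] , [] ∷ [] , s≤s z≤n)
  distinct-windows (suc n) none = distinct-windows n λ (is , distinct , n<) →
    right-special n λ (p , p′ , eq , neq) →
    -- The window at `p`, listed at most once, is traded for its two extensions, at `p` and `p′`.
    let other = λ i → ¬? (win w i n ≟L win w p n)
        rest  = filter other is
        new : ∀ {j} → win w j n ≡ win w p n → All (λ i → win w j (suc n) ≢ win w i (suc n)) rest
        new {j} eq = All.map (λ {i} ≢p eq′ → ≢p (trans (sym (win-init {w = w} j i n eq′)) eq)) (all-filter other is)
    in none (p ∷ p′ ∷ rest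
        , ((λ eq → neq (win-injective {w = w} p p′ (suc n) eq n (ℕ.n<1+n n))) ∷ new refl)
          ∷ new (sym eq)
          ∷ AllPairs.filter⁺ other (AllPairs.map (λ {i} {j} neq eq → neq (win-init {w = w} i j n eq)) distinct)
        , s≤s (ℕ.≤-trans n< (length-remove _≟L_ (λ i → win w i n) (win w p n) is distinct)))

-- Growth of the images of letters.

module Growth {σ} {φ : Morphism σ} {w : Word σ} (gen : GeneratedBy w φ) where
  open Generated gen

  length-concatMap-≤ : ∀ {Λ} → (∀ e → length (φ e) ≤ Λ) → ∀ u → length (concatMap φ u) ≤ Λ * length u
  length-concatMap-≤ {Λ} ≤Λ []      = z≤n
  length-concatMap-≤ {Λ} ≤Λ (x ∷ u) = begin
    length (φ x ++ concatMap φ u)          ≡⟨ List.length-++ (φ x) ⟩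
    length (φ x) + length (concatMap φ u)  ≤⟨ ℕ.+-mono-≤ (≤Λ x) (length-concatMap-≤ ≤Λ u) ⟩
    Λ + Λ * length u                       ≡⟨ ℕ.*-suc Λ (length u) ⟨
    Λ * length (x ∷ u)                     ∎
    where open ℕ.≤-Reasoning

  length-iter-≤ : ∀ {Λ} → (∀ e → length (φ e) ≤ Λ) → ∀ k u → length (iter φ k u) ≤ Λ ^ k * length u
  length-iter-≤ {Λ} ≤Λ zero    u = ℕ.≤-reflexive (sym (ℕ.+-identityʳ _))
  length-iter-≤ {Λ} ≤Λ (suc k) u = begin
    length (concatMap φ (iter φ k u))  ≤⟨ length-concatMap-≤ ≤Λ (iter φ k u) ⟩
    Λ * length (iter φ k u)            ≤⟨ ℕ.*-monoʳ-≤ Λ (length-iter-≤ ≤Λ k u) ⟩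
    Λ * (Λ ^ k * length u)             ≡⟨ ℕ.*-assoc Λ (Λ ^ k) (length u) ⟨
    Λ ^ suc k * length u               ∎
    where open ℕ.≤-Reasoning

  length-power-letter : ∀ N (f : Word σ) n i → i < n → length (power φ N (f i)) ≤ length (iter φ N (applyUpTo f n))
  length-power-letter N f n i i<n = subst (λ u → _ ≤ length u) (sym (iter≡concatMap φ N (applyUpTo f n))) (go f n i i<n)
    where
    go : ∀ (f : Word σ) n i → i < n → length (power φ N (f i)) ≤ length (concatMap (power φ N) (applyUpTo f n))
    go f (suc n) zero    _         = ℕ.≤-trans (ℕ.m≤m+n _ _) (ℕ.≤-reflexive (sym (List.length-++ (power φ N (f 0)))))
    go f (suc n) (suc i) (s≤s i<n) = ℕ.≤-trans (go (f ∘ suc) n i i<n)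
      (ℕ.≤-trans (ℕ.m≤n+m _ _) (ℕ.≤-reflexive (sym (List.length-++ (power φ N (f 0))))))

  -- All letters occur in some φᵏ(a), so |φᴺ(e)| ≤ |φᴺ(φᵏ(a))| = |φᵏ(φᴺ(a))|.
  generator-growth : WELLDOC w → ∃[ c ] (∀ N e → length (power φ N e) ≤ c * length (power φ N a))
  generator-growth wd with bounded (λ e → length (φ e)) | bounded (λ e → proj₁ (letter-occurs wd e))
  ... | Λ , ≤Λ | k , ≤k with iter-grows k
  ...   | l , k<l , eq = Λ ^ k , λ N e → begin
    length (power φ N e)
      ≡⟨ cong (length ∘ power φ N) (proj₂ (letter-occurs wd e)) ⟨
    length (power φ N (w (proj₁ (letter-occurs wd e))))
      ≤⟨ length-power-letter N w l _ (ℕ.≤-<-trans (≤k e) k<l) ⟩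
    length (iter φ N (applyUpTo w l))
      ≡⟨ cong (length ∘ iter φ N) eq ⟨
    length (iter φ N (iter φ k [ a ]))
      ≡⟨ cong length (iter-+ φ N k [ a ]) ⟨
    length (iter φ (N + k) [ a ])
      ≡⟨ cong (λ n → length (iter φ n [ a ])) (ℕ.+-comm N k) ⟩
    length (iter φ (k + N) [ a ])
      ≡⟨ cong length (iter-+ φ k N [ a ]) ⟩
    length (iter φ k (power φ N a))
      ≤⟨ length-iter-≤ ≤Λ k (power φ N a) ⟩
    Λ ^ k * length (power φ N a) ∎
    where open ℕ.≤-Reasoning

-- Frequency of a letter with bounded gaps.

countL-∈ : ∀ {σ} (a : Fin σ) f n t → t < n → f t ≡ a → 1 ≤ countL a (applyUpTo f n)
countL-∈ a f (suc n) zero    _         eq with f 0 ≟ a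
... | yes _  = s≤s z≤n
... | no  f≢ = ⊥-elim (f≢ eq)
countL-∈ a f (suc n) (suc t) (s≤s t<n) eq with f 0 ≟ a
... | yes _ = s≤s z≤n
... | no  _ = countL-∈ a (f ∘ suc) n t t<n eq

countL*length≤ : ∀ {σ} (g : Morphism σ) a u → countL a u * length (g a) ≤ length (concatMap g u)
countL*length≤ g a []      = z≤n
countL*length≤ g a (x ∷ u) rewrite List.length-++ (g x) {concatMap g u} with x ≟ a
... | yes refl = ℕ.+-monoʳ-≤ (length (g a)) (countL*length≤ g a u)
... | no  _    = ℕ.≤-trans (countL*length≤ g a u) (ℕ.m≤n+m _ (length (g x)))

module _ {σ} {w : Word σ} {a : Fin σ} where

  -- When the start moves forward, the occurrence found before stays ahead unless it stood at the
  -- start itself; in that case its return is taken.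
  return-in-window : w 0 ≡ a → ∀ {L} → (∀ i → w i ≡ a → ∃[ t ] (t < L × w (i + suc t) ≡ a)) →
    ∀ i → ∃[ t ] (t < suc L × w (i + t) ≡ a)
  return-in-window w0≡a return zero    = 0 , s≤s z≤n , w0≡a
  return-in-window w0≡a return (suc i) with return-in-window w0≡a return i
  ... | suc t , s≤s t<L , eq = t , ℕ.m<n⇒m<1+n t<L , trans (cong w (sym (ℕ.+-suc i t))) eq
  ... | zero  , _ , eq with return i (trans (cong w (sym (ℕ.+-identityʳ i))) eq)
  ...   | t , t<L , eq′ = t , ℕ.m<n⇒m<1+n t<L , trans (cong w (sym (ℕ.+-suc i t))) eq′

  count-windows : ∀ {L} → (∀ i → ∃[ t ] (t < L × w (i + t) ≡ a)) →
    ∀ n i → n ≤ countL a (win w i (n * L))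
  count-windows window zero    i = z≤n
  count-windows {L} window (suc n) i = begin
    1 + n
      ≤⟨ ℕ.+-mono-≤ (countL-∈ a (shift w i) L _ (proj₁ (proj₂ (window i))) (proj₂ (proj₂ (window i))))
           (count-windows window n (i + L)) ⟩
    countL a (win w i L) + countL a (win w (i + L) (n * L))
      ≡⟨ countL-++ a (win w i L) _ ⟨
    countL a (win w i L ++ win w (i + L) (n * L))
      ≡⟨ cong (countL a) (win-+ w i L (n * L)) ⟨
    countL a (win w i (suc n * L)) ∎
    where open ℕ.≤-Reasoning

-- Factors with few classes of occurrences.

module _ {σ} {g : Morphism σ} {w : Word σ} (fixes : Fixes g w) (nonempty : ∀ e → 0 < length (g e)) where
  open Blocks fixes nonempty

  -- The gap makes the initial a the last one in its block, so the letter below the block determines the offset.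
  last-letter-classified : ∀ {a H} → (∀ e → length (g e) ≤ H) → ∀ i₀ → w i₀ ≡ a →
    (∀ t → t < H → w (i₀ + suc t) ≢ a) → Classified w (Aφ g) (win w i₀ (suc H)) σ
  last-letter-classified {a} {H} ≤H i₀ wi₀≡a gap = record
    { class    = λ i _ → w (block (locate i))
    ; coherent = λ {i} {i′} p p′ eq → same-coset (locate i) (locate i′) eq (same-offset p p′ (locate i) (locate i′) eq)
    }
    where
    open ≡-Reasoning
    u = win w i₀ (suc H)
    letter : ∀ {i} → OccursAt w u i → ∀ t → t < suc H → w (i + t) ≡ w (i₀ + t)
    letter {i} p = win-injective {w = w} i i₀ (suc H) (occursAt-win w i₀ (suc H) p)
    absurd : ∀ {i i′} → OccursAt w u i → OccursAt w u i′ → (p : Position i) (p′ : Position i′) →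
      w (block p) ≡ w (block p′) → ¬ offset p < offset p′
    -- Blocks of one letter have the same text, so the `a` at the larger offset `o′` of its block
    -- also stands at `o′` in the other block, within `H` letters after the `a` at `o`, against the
    -- gap.
    absurd occ occ′ (position k o refl o<) (position k′ o′ refl o′<) eq o<o′ = gap t t<H (begin
      w (i₀ + suc t)
        ≡⟨ letter occ (suc t) (s≤s t<H) ⟨
      w (cut k + o + suc t)
        ≡⟨ cong w (trans (ℕ.+-assoc (cut k) o (suc t)) (cong (λ n → cut k + n) o+1+t≡o′)) ⟩
      w (cut k + o′)
        ≡⟨ letter-in-block eq o′ (subst (λ e → o′ < length (g e)) (sym eq) o′<) ⟩
      w (cut k′ + o′)
        ≡⟨ cong w (ℕ.+-identityʳ _) ⟨
      w (cut k′ + o′ + 0)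
        ≡⟨ letter occ′ 0 (s≤s z≤n) ⟩
      w (i₀ + 0)
        ≡⟨ trans (cong w (ℕ.+-identityʳ i₀)) wi₀≡a ⟩
      a ∎)
      where
      t = o′ ∸ suc o
      o+1+t≡o′ : o + suc t ≡ o′
      o+1+t≡o′ = trans (ℕ.+-suc o t) (ℕ.m+[n∸m]≡n o<o′)
      t<H : t < H
      t<H = ℕ.≤-trans (s≤s (ℕ.m∸n≤m o′ (suc o))) (ℕ.≤-trans o′< (≤H _))
    same-offset : ∀ {i i′} → OccursAt w u i → OccursAt w u i′ → (p : Position i) (p′ : Position i′) →
      w (block p) ≡ w (block p′) → offset p ≡ offset p′
    same-offset occ occ′ p p′ eq with ℕ.<-cmp (offset p) (offset p′)
    ... | tri< lt _ _ = ⊥-elim (absurd occ occ′ p p′ eq lt)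
    ... | tri≈ _ o≡ _ = o≡
    ... | tri> _ _ gt = ⊥-elim (absurd occ′ occ p′ p (sym eq) gt)

  -- A window of length H is determined by 1 + R consecutive letters of w and an offset below H, that is, by one of
  -- K H data where K = |words σ (1 + R)|. There are more than H windows, so some window comes from at most K data.
  rare-window-classified : ∀ {H R} → (∀ e → length (g e) ≤ H) →
    (∀ k → length (g (w k)) + H ≤ length (concatMap g (win w k (suc R)))) →
    ∀ is → AllPairs (λ i j → win w i H ≢ win w j H) is → H < length is →
    ∃[ i ] Classified w (Aφ g) (win w i H) (length (words σ (suc R)))
  rare-window-classified {H} {R} ≤H long is distinct H<
    with small-fibre _≟L_ text (λ i → win w i H) (length contexts) is distinct types few
    where
    contexts = words σ (suc R)
    types = cartesianProduct contexts (upTo H)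
    text : List (Fin σ) × ℕ → List (Fin σ)
    text (x , o) = take H (drop o (concatMap g x))
    few : length types < length is * suc (length contexts)
    few = begin-strict
      length types                      ≡⟨ length-cartesianProductWith _,_ contexts (upTo H) ⟩
      length contexts * length (upTo H) ≡⟨ cong (length contexts *_) (List.length-upTo H) ⟩
      length contexts * H               ≡⟨ ℕ.*-comm (length contexts) H ⟩
      H * length contexts               ≤⟨ ℕ.*-monoʳ-≤ H (ℕ.n≤1+n _) ⟩
      H * suc (length contexts)         <⟨ ℕ.*-monoˡ-< (suc (length contexts)) H< ⟩
      length is * suc (length contexts) ∎
      where open ℕ.≤-Reasoning
  ... | i₀ , _ , ys , few , covers = i₀ , record
    -- The class is the place of the pair (letters of w, offset) in `ys`, a list short enough to
    -- index by the required number of classes.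
    { class    = λ i p → inject≤ (Any.index (member i p)) few
    ; coherent = λ {i} {i′} p p′ eq →
        let same = trans (lookup-index (member i p)) (trans
              (cong (List.lookup ys) (inject≤-injective few few _ _ eq)) (sym (lookup-index (member i′ p′))))
        in same-coset (locate i) (locate i′) (first-letter (cong proj₁ same)) (cong proj₂ same)
    }
    where
    type : ℕ → List (Fin σ) × ℕ
    type i = win w (block (locate i)) (suc R) , offset (locate i)
    first-letter : ∀ {k k′} → win w k (suc R) ≡ win w k′ (suc R) → w k ≡ w k′
    first-letter {k} {k′} eq = trans (cong w (sym (ℕ.+-identityʳ k)))
      (trans (List.∷-injectiveˡ eq) (cong w (ℕ.+-identityʳ k′)))
    type-text : ∀ {i} (p : Position i) →
      take H (drop (offset p) (concatMap g (win w (block p) (suc R)))) ≡ win w i H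
    -- An offset inside the first block leaves, by `long`, at least `H` letters of the image.
    type-text (position k o refl o<) = sym (win-in-image k (suc R) o H
      (ℕ.≤-trans (ℕ.+-monoˡ-≤ H (ℕ.<⇒≤ o<)) (long k)))
    member : ∀ i → OccursAt w (win w i₀ H) i → type i ∈ ys
    member i p = covers
      (∈-cartesianProduct⁺ (∈-words (shift w _) (suc R)) (∈-upTo⁺ (ℕ.<-≤-trans (inside (locate i)) (≤H _))))
      (trans (type-text (locate i)) (occursAt-win w i₀ H p))

-- Choice of exponents and the contradiction.

module _ {σ} {φ : Morphism (suc (suc σ))} {w : Word (suc (suc σ))} (gen : GeneratedBy w φ)
         (det≢1 : ¬ det (Aφ φ) ≡ + 1) (det≢-1 : ¬ det (Aφ φ) ≡ -[1+ 0 ]) (wd : WELLDOC w) where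
  open Generated gen
  open Growth gen

  -- The bound on |det Mᴺ| for `K` classes, reused as the exponent N itself: a determinant d of
  -- absolute value at least 2 has |d|ᴺ > N.
  exponent : ℕ → ℕ
  exponent K = (K !) ^ suc (suc σ)

  ¬classified : ∀ K i n → ¬ Classified w (Aφ (power φ (exponent K))) (win w i n) K
  ¬classified K i n cl = contra (det (Aφ φ)) det≢1 det≢-1 (exponent K) {{ℕ.m^n≢0 (K !) (suc (suc σ)) {{K ℕ.!≢0}}}} bounds
    where
    bounds : 0 < ∣ det (Aφ φ) ℤ.^ exponent K ∣ × ∣ det (Aφ φ) ℤ.^ exponent K ∣ ≤ exponent K
    bounds = subst (λ D → 0 < ∣ D ∣ × ∣ D ∣ ≤ exponent K) (det-power φ (exponent K))
      (det-bounds wd (win-isFactor w i n) cl)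
    ∣^∣ : ∀ d n → ∣ d ℤ.^ n ∣ ≡ ∣ d ∣ ^ n
    ∣^∣ d zero    = refl
    ∣^∣ d (suc n) = trans (ℤ.abs-* d (d ℤ.^ n)) (cong (∣ d ∣ *_) (∣^∣ d n))
    contra : ∀ d → ¬ d ≡ + 1 → ¬ d ≡ -[1+ 0 ] → ∀ n .{{_ : NonZero n}} →
      ¬ (0 < ∣ d ℤ.^ n ∣ × ∣ d ℤ.^ n ∣ ≤ n)
    contra d d≢1 d≢-1 n (0< , ≤n) rewrite ∣^∣ d n = cases d d≢1 d≢-1 n 0< ≤n
      where
      cases : ∀ d → ¬ d ≡ + 1 → ¬ d ≡ -[1+ 0 ] → ∀ n .{{_ : NonZero n}} → 0 < ∣ d ∣ ^ n → ¬ ∣ d ∣ ^ n ≤ n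
      -- The exponent is positive, so the power of 0 is 0 and not 0⁰ = 1.
      cases (+ 0)           _   _    (suc n) () _
      cases (+ 1)           d≢1 _    n _ _  = d≢1 refl
      cases (+ suc (suc d)) _   _    n _ ≤n = ℕ.<-irrefl refl (ℕ.<-≤-trans (n<m^n (2 + d) n (s≤s (s≤s z≤n))) ≤n)
      cases -[1+ 0 ]        _   d≢-1 n _ _  = d≢-1 refl
      cases -[1+ suc d ]    _   _    n _ ≤n = ℕ.<-irrefl refl (ℕ.<-≤-trans (n<m^n (2 + d) n (s≤s (s≤s z≤n))) ≤n)

  c : ℕ
  c = proj₁ (generator-growth wd)

  H : ℕ → ℕ
  H N = c * length (power φ N a)

  length-power≤H : ∀ N e → length (power φ N e) ≤ H N
  length-power≤H = proj₂ (generator-growth wd)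

  -- A gap of this length would give a factor with |Σ| classes, so the power is the one excluded for
  -- K = |Σ|.
  L : ℕ
  L = H (exponent (suc (suc σ)))

  bounded-gaps : ∀ i → w i ≡ a → ∃[ t ] (t < L × w (i + suc t) ≡ a)
  bounded-gaps i wi≡a with ℕ.anyUpTo? (λ t → w (i + suc t) ≟ a) L
  ... | yes found = found
  ... | no  none  = ⊥-elim (¬classified (suc (suc σ)) i (suc L)
    (last-letter-classified (power-fixes N) (power-nonempty N) (length-power≤H N) i wi≡a
      (λ t t<L eq → none (t , t<L , eq))))
    where N = exponent (suc (suc σ))

  -- Room for `c` windows of length `suc L`, each containing an `a`, so that the image under φᴺ has
  -- length at least c |φᴺ(a)| for every N.
  R : ℕ
  R = c * suc L

  long-image : ∀ N k → length (power φ N (w k)) + H N ≤ length (concatMap (power φ N) (win w k (suc R)))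
  long-image N k = begin
    length (g (w k)) + c * length (g a)
      ≤⟨ ℕ.+-monoʳ-≤ (length (g (w k))) (ℕ.≤-trans
           (ℕ.*-monoˡ-≤ (length (g a)) (count-windows {w = w} (return-in-window {w = w} w0≡a bounded-gaps) c (suc k)))
           (countL*length≤ g a (win w (suc k) R))) ⟩
    length (g (w k)) + length (concatMap g (win w (suc k) R))
      ≡⟨ List.length-++ (g (w k)) ⟨
    length (concatMap g (w k ∷ win w (suc k) R))
      ≡⟨ cong (length ∘ concatMap g) (cong₂ _∷_ (cong w (ℕ.+-identityʳ k))
           (applyUpTo-cong R (λ t _ → cong w (ℕ.+-suc k t)))) ⟨
    length (concatMap g (win w k (suc R))) ∎
    where
    open ℕ.≤-Reasoning
    g = power φ N

  generated⇒⊥ : ⊥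
  generated⇒⊥ = distinct-windows wd (H N) λ (is , distinct , many) →
    let i , cl = rare-window-classified (power-fixes N) (power-nonempty N) {H N} {R} (length-power≤H N) (long-image N) is distinct many
    in ¬classified K i (H N) cl
    where
    -- `K` involves only `R` and the alphabet, so N may be chosen after it.
    K = length (words (suc (suc σ)) (suc R))
    N = exponent K

theorem9 : (σ : ℕ) → σ ≥ 2 → (φ : Morphism σ) → (w : Word σ) →
    GeneratedBy w φ →
    ¬ (det (Aφ φ) ≡ + 1) → ¬ (det (Aφ φ) ≡ -[1+ 0 ]) →
    ¬ WELLDOC w
theorem9 (suc (suc σ)) (s≤s (s≤s z≤n)) φ w gen det≢1 det≢-1 wd = generated⇒⊥ gen det≢1 det≢-1 wd
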